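{- Let $G$ be a $2$-connected multigraph. Then the following are equivalent: (1) $G$ satisfies $(\spadesuit)_2$; (2) either $G$ is the $2$-cycle $C_2$, or $G$ can be obtained from cliques $K_4$ by repeated applications of Construction A with $\delta=2$ (i.e. $G$ belongs to the smallest class of multigraphs containing $K_4$ and closed under Construction A with $\delta=2$).
   Context: Multigraphs are finite, undirected, loop-free, and may have parallel edges. $C_2$ is the multigraph with two vertices and two parallel edges between them; $K_4$ is the complete simple graph on four vertices. For a multigraph $G=(V,E)$ and $S\subseteq V$, $E(S)$ denotes the set of edges with both endpoints in $S$, $G|_S$ the induced sub-multigraph on $S$, and $G/E(S)$ the result of contracting $E(S)$. A good flat of a $2$-connected multigraph $G=(V,E)$ is a subset $S\subsetneq V$ such that both $G|_S$ and $G/E(S)$ are $2$-connected. For an integer $\delta\ge 2$ and a $2$-connected multigraph $G=(V,E)$, the weight function $w\colon E\to\{1,\delta-1\}$ is given by $w(e)=1$ if $G\setminus e$ is $2$-connected and $w(e)=\delta-1$ if $G/e$ is $2$-connected; $w(F)=\sum_{e\in F}w(e)$. $G$ satisfies $(\spadesuit)_\delta$ if it possesses such a weight function and (1) $w(E)=\delta(|V|-1)$ and (2) $w(E(S))+1=\delta(|S|-1)$ for every good flat $S$. (For $\delta=2$ all weights equal $1$.) Construction A (parameter $\delta$): given $2$-connected multigraphs $G_1,G_2$ and edges $e_1$ of $G_1$ with $w(e_1)=1$ and $e_2$ of $G_2$ with $w(e_2)=\delta-1$, take the disjoint union, identify the endpoints of $e_1$ with those of $e_2$ (so that $e_1,e_2$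 become one glued edge), and delete the glued edge. -}

module Defs where

open import Data.Nat using (ℕ; zero; suc; _+_; _*_; _∸_; _≤_)
open import Data.Fin using (Fin; zero; suc; _≟_)
open import Data.Bool using (Bool; true; false; not; _∧_; T; if_then_else_)
open import Data.Unit using (⊤; tt)
open import Data.Product using (Σ; Σ-syntax; ∃; ∃-syntax; _×_; _,_; proj₁; proj₂)
open import Data.Sum using (_⊎_; inj₁; inj₂)
open import Function using (_∘_)
open import Function.Bundles using (_↔_; Inverse)
open import Relation.Nullary using (¬_; does)
open import Relation.Binary.PropositionalEquality using (_≡_; _≢_)
open import Relation.Binary.Construct.Closure.ReflexiveTransitive using (Star)

-- Unordered equality of endpoint pairs (edges are undirected)

UEq : {A : Set} → A × A → A × A → Set
UEq (a , b) (c , d) = ((a ≡ c) × (b ≡ d)) ⊎ ((a ≡ d) × (b ≡ c))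

mapPair : {A B : Set} → (A → B) → A × A → B × B
mapPair f (a , b) = f a , f b

record Gr : Set₁ where
  field
    V    : Set
    E    : Set
    ends : E → V × V

open Gr public

Adj : (H : Gr) → (V H → Set) → V H → V H → Set
Adj H P x y = P x × P y × Σ[ e ∈ E H ] UEq (ends H e) (x , y)

ConnectedOn : (H : Gr) → (V H → Set) → Set
ConnectedOn H P = ∀ x y → P x → P y → Star (Adj H P) x y

TwoConn : Gr → Set
TwoConn H =
  (∀ e → proj₁ (ends H e) ≢ proj₂ (ends H e)) ×
  (Σ[ x ∈ V H ] Σ[ y ∈ V H ] x ≢ y) ×
  ConnectedOn H (λ _ → ⊤) ×
  (∀ v → ConnectedOn H (λ x → x ≢ v))

record MGraph : Set where
  field
    n    : ℕ
    m    : ℕ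
    ends : Fin m → Fin n × Fin n

open MGraph public renaming (ends to endsG)

toGr : MGraph → Gr
toGr G = record { V = Fin (n G) ; E = Fin (m G) ; ends = endsG G }

LoopFree : MGraph → Set
LoopFree G = ∀ e → proj₁ (endsG G e) ≢ proj₂ (endsG G e)

Subset : ℕ → Set
Subset k = Fin k → Bool

sumF : ∀ {k} → (Fin k → ℕ) → ℕ
sumF {zero}  f = 0
sumF {suc k} f = f zero + sumF (f ∘ suc)

size : ∀ {k} → Subset k → ℕ
size S = sumF (λ x → if S x then 1 else 0)

inE : (G : MGraph) → Subset (n G) → Fin (m G) → Bool
inE G S e = S (proj₁ (endsG G e)) ∧ S (proj₂ (endsG G e))

induced : (G : MGraph) → Subset (n G) → Gr
induced G S = record
  { V = Σ[ x ∈ Fin (n G) ] T (S x)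
  ; E = Σ[ e ∈ Fin (m G) ] (T (S (proj₁ (endsG G e))) × T (S (proj₂ (endsG G e))))
  ; ends = λ { (e , p , q) → (proj₁ (endsG G e) , p) , (proj₂ (endsG G e) , q) }
  }

-- quotient: identify all vertices of S into one new vertex (tt),
-- keeping exactly the edges selected by `keep` (endpoints mapped)
QV : (G : MGraph) → Subset (n G) → Set
QV G S = (Σ[ x ∈ Fin (n G) ] T (not (S x))) ⊎ ⊤

private
  go : {X : Set} (b : Bool) → (T (not b) → X) → X ⊎ ⊤
  go true  k = inj₂ tt
  go false k = inj₁ (k tt)

qmap : (G : MGraph) (S : Subset (n G)) → Fin (n G) → QV G S
qmap G S x = go (S x) (λ p → x , p)

quot : (G : MGraph) → Subset (n G) → (Fin (m G) → Bool) → Gr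
quot G S keep = record
  { V = QV G S
  ; E = Σ[ e ∈ Fin (m G) ] T (keep e)
  ; ends = λ { (e , _) → mapPair (qmap G S) (endsG G e) }
  }

contractSet : (G : MGraph) → Subset (n G) → Gr
contractSet G S = quot G S (λ e → not (inE G S e))

delete : (G : MGraph) → Fin (m G) → Gr
delete G e = record
  { V = Fin (n G)
  ; E = Σ[ f ∈ Fin (m G) ] T (not (does (f ≟ e)))
  ; ends = λ { (f , _) → endsG G f }
  }

-- G / e : identify the two endpoints of e, delete e (parallel copies of e become loops)
contractEdge : (G : MGraph) → Fin (m G) → Gr
contractEdge G e =
  quot G (λ x → does (x ≟ proj₁ (endsG G e)) Data.Bool.∨ does (x ≟ proj₂ (endsG G e)))
         (λ f → not (does (f ≟ e)))

-- "w(e) is well defined and equals k"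
WeightIs : ℕ → (G : MGraph) → Fin (m G) → ℕ → Set
WeightIs δ G e k =
  (TwoConn (delete G e) → k ≡ 1) ×
  (TwoConn (contractEdge G e) → k ≡ δ ∸ 1) ×
  (TwoConn (delete G e) ⊎ TwoConn (contractEdge G e))

IsWeight : ℕ → (G : MGraph) → (Fin (m G) → ℕ) → Set
IsWeight δ G w = ∀ e → WeightIs δ G e (w e)

wE : (G : MGraph) → (Fin (m G) → ℕ) → Subset (n G) → ℕ
wE G w S = sumF (λ e → if inE G S e then w e else 0)

GoodFlat : (G : MGraph) → Subset (n G) → Set
GoodFlat G S =
  (∃[ x ] S x ≡ false) × TwoConn (induced G S) × TwoConn (contractSet G S)

Spade : ℕ → MGraph → Set
Spade δ G = Σ[ w ∈ (Fin (m G) → ℕ) ]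
  IsWeight δ G w ×
  (sumF w ≡ δ * (n G ∸ 1)) ×
  (∀ S → GoodFlat G S → wE G w S + 1 ≡ δ * (size S ∸ 1))

IsC2 : MGraph → Set
IsC2 G = (n G ≡ 2) × (m G ≡ 2) × LoopFree G

IsK4 : MGraph → Set
IsK4 G = (n G ≡ 4) × LoopFree G ×
  (∀ u v → u ≢ v →
     Σ[ e ∈ Fin (m G) ] (UEq (endsG G e) (u , v) ×
       (∀ f → UEq (endsG G f) (u , v) → f ≡ e)))

-- Construction A: H is (up to relabelling) obtained from G₁, G₂ by
-- gluing e₁ to e₂ and deleting the glued edge.

record ConstrA (δ : ℕ) (G₁ G₂ H : MGraph) : Set where
  field
    tc₁ : TwoConn (toGr G₁)
    tc₂ : TwoConn (toGr G₂)
    e₁  : Fin (m G₁)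
    e₂  : Fin (m G₂)
    w₁  : WeightIs δ G₁ e₁ 1
    w₂  : WeightIs δ G₂ e₂ (δ ∸ 1)
    φ₁  : Fin (n G₁) → Fin (n H)
    φ₂  : Fin (n G₂) → Fin (n H)
    φ₁-inj : ∀ x y → φ₁ x ≡ φ₁ y → x ≡ y
    φ₂-inj : ∀ x y → φ₂ x ≡ φ₂ y → x ≡ y
    cover  : ∀ z → (∃[ x ] φ₁ x ≡ z) ⊎ (∃[ y ] φ₂ y ≡ z)
    glue   : UEq (mapPair φ₁ (endsG G₁ e₁)) (mapPair φ₂ (endsG G₂ e₂))
    only-glue : ∀ x y → φ₁ x ≡ φ₂ y → (x ≡ proj₁ (endsG G₁ e₁)) ⊎ (x ≡ proj₂ (endsG G₁ e₁))
    ψ : ((Σ[ f ∈ Fin (m G₁) ] T (not (does (f ≟ e₁)))) ⊎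
         (Σ[ f ∈ Fin (m G₂) ] T (not (does (f ≟ e₂))))) ↔ Fin (m H)
    ψ-ends₁ : ∀ f → UEq (endsG H (Inverse.to ψ (inj₁ f))) (mapPair φ₁ (endsG G₁ (proj₁ f)))
    ψ-ends₂ : ∀ f → UEq (endsG H (Inverse.to ψ (inj₂ f))) (mapPair φ₂ (endsG G₂ (proj₁ f)))

data ClassA (δ : ℕ) : MGraph → Set where
  base : ∀ {G} → IsK4 G → ClassA δ G
  step : ∀ {G₁ G₂ H} → ClassA δ G₁ → ClassA δ G₂ → ConstrA δ G₁ G₂ H → ClassA δ H

{-# OPTIONS --safe #-}
-- Since 2-connectivity of G/E(S) amounts to connectedness of V ∖ S, the good flats S are the
-- 2-connected sets with connected complement, and (♠)₂ says |E| = 2|V| − 2 and |E(S)| = 2|S| − 3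
-- for these. If the complement of a 2-connected set S falls apart, adding either part to S keeps
-- it 2-connected, so by induction |E(S)| ≤ 2|S| − 4; splitting at cut vertices then gives
-- |E(S)| ≤ 2|S| − 3 for every proper S with at least two vertices, with equality only at good flats.
--
-- Without a 2-vertex cut every V ∖ {v} is a good flat, so all degrees are 3, |V| = 4 and G = K₄.
-- A 2-vertex cut {u , v} covers V by two sets meeting in {u , v}; counting forces equality in both
-- bounds, so u and v are not adjacent, both sides are 2-connected, and G arises from the two sides,
-- each with an additional edge uv, by Construction A. A good flat of one side either misses
-- u or v and is a good flat of G, or contains both and becomes one after adding the other side.
-- The same correspondence of good flats shows that Construction A preserves (♠)₂.
module Submission where

open import Defs
open import Data.Nat using (ℕ; zero; suc; _+_; _*_; _∸_; _≤_; _<_; z≤n; s≤s)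
open import Data.Nat.Properties hiding (suc-injective)
open import Data.Nat.Tactic.RingSolver using (solve-∀)
open import Data.Fin using (Fin; zero; suc; #_)
import Data.Fin as F
import Data.Bool as 𝔹
open import Data.Fin.Properties using (any?; all?; suc-injective)
open import Data.Bool using (Bool; true; false; not; _∧_; _∨_; T; if_then_else_)
open import Data.Bool.Properties using (T-≡; T-not-≡; T-irrelevant; ∧-comm)
open import Data.Unit using (⊤; tt)
open import Data.Empty using (⊥; ⊥-elim)
open import Data.Product using (Σ-syntax; ∃; ∃-syntax; _×_; _,_; proj₁; proj₂)
open import Data.Sum using (_⊎_; inj₁; inj₂; swap) renaming (map to ⊎-map)
open import Data.Sum.Properties using (inj₁-injective; swap-involutive)
open import Function using (_∘_; id)
open import Function.Bundles using (Equivalence; _↔_; Inverse; mk↔ₛ′; _⇔_; mk⇔)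
open import Relation.Nullary using (¬_; does; Dec; yes; no)
open import Relation.Nullary.Decidable using (dec-true; dec-false; _×-dec_; _⊎-dec_; _→-dec_; ¬?; from-yes)
open import Relation.Binary.PropositionalEquality
open import Relation.Binary.Construct.Closure.ReflexiveTransitive using (Star; ε; _◅_; _◅◅_)

-- Induced subgraphs, contractions and deletions have vertex or edge types of their own.
-- Connectedness is therefore restated through two-valued colourings that are constant along edges:
-- a statement about a set stays a statement about `G`, colourings are easily extended from one side
-- of a graph to the other, and a failure is a concrete `Cut`, the very bipartition along which the
-- counting arguments split. Walks occur only in the search for cuts and in the translation from and
-- to the given definitions. For δ = 2 every admissible weight is 1, but its existence is still a
-- condition: each edge needs a 2-connected deletion or contraction. This holds in every 2-connected
-- graph with at least two edges. The constants come from splitting `Q` into `L` and `R` that meet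
-- in a core: |L| + |R| = |Q| + |core|, and likewise for edges. Two bounds with constant 3 add up to
-- 6; a cut vertex uses up 2 of it, and so does 2|V| = |E| + 2 when `Q` is all of V. What remains is
-- 4, one better than 3. At a 2-vertex cut exactly 6 is available, so nothing may be lost there.

private variable
  k l : ℕ

-- Booleans, indicators and finite choice.

𝟙 : Bool → ℕ
𝟙 b = if b then 1 else 0

is : Fin k → Fin k → Bool
is i j = does (j F.≟ i)

is-refl : (i : Fin k) → is i i ≡ true
is-refl i = dec-true (i F.≟ i) refl

is-≢ : {i j : Fin k} → j ≢ i → is i j ≡ false
is-≢ {i = i} {j} ne = dec-false (j F.≟ i) ne

is-true : {i j : Fin k} → is i j ≡ true → j ≡ i
is-true {i = i} {j} eq with j F.≟ i
... | yes p = p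
is-true {i = i} {j} () | no _

is-false : {i j : Fin k} → is i j ≡ false → j ≢ i
is-false {i = i} eq refl with trans (sym eq) (is-refl i)
... | ()

T⇒≡ : {b : Bool} → T b → b ≡ true
T⇒≡ = Equivalence.to T-≡

≡⇒T : {b : Bool} → b ≡ true → T b
≡⇒T = Equivalence.from T-≡

true≢false : {b : Bool} → b ≡ true → b ≢ false
true≢false refl ()

true⊎false : (b : Bool) → b ≡ true ⊎ b ≡ false
true⊎false true  = inj₁ refl
true⊎false false = inj₂ refl

not-true : ∀ {b} → not b ≡ true → b ≡ false
not-true {false} _ = refl

not-false : ∀ {b} → not b ≡ false → b ≡ true
not-false {true} _ = refl

∧-true : ∀ {a b} → a ∧ b ≡ true → a ≡ true × b ≡ true
∧-true {true} {true} _ = refl , refl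

∨-false : ∀ {a b} → a ∨ b ≡ false → a ≡ false × b ≡ false
∨-false {false} {false} _ = refl , refl

∨-true : ∀ {a b} → a ∨ b ≡ true → a ≡ true ⊎ b ≡ true
∨-true {true} _ = inj₁ refl
∨-true {false} eq = inj₂ eq

∧-interchange : ∀ a b c d → (a ∧ b) ∧ (c ∧ d) ≡ (a ∧ c) ∧ (b ∧ d)
∧-interchange true  true  c d = refl
∧-interchange true  false true  d = refl
∧-interchange true  false false d = refl
∧-interchange false b c d = refl

-- Only a disjunction is asked for at each point, so `B` may be a statement such as `Conn`, for
-- which the alternative to a cut is what is available.
choose : {A B : Fin k → Set} → (∀ x → A x ⊎ B x) → (∃ A) ⊎ (∀ x → B x)
choose {zero}  f = inj₂ λ ()
choose {suc k} f with f zero | choose (f ∘ suc)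
... | inj₁ a | _ = inj₁ (zero , a)
... | inj₂ b | inj₁ (x , a) = inj₁ (suc x , a)
... | inj₂ b | inj₂ bs = inj₂ λ { zero → b ; (suc x) → bs x }

-- Sums

sumF-cong : {f g : Fin k → ℕ} → (∀ i → f i ≡ g i) → sumF f ≡ sumF g
sumF-cong {zero}  eq = refl
sumF-cong {suc k} eq = cong₂ _+_ (eq zero) (sumF-cong (eq ∘ suc))

sumF-0 : {f : Fin k → ℕ} → (∀ i → f i ≡ 0) → sumF f ≡ 0
sumF-0 {zero}  eq = refl
sumF-0 {suc k} eq = cong₂ _+_ (eq zero) (sumF-0 (eq ∘ suc))

sumF-const : ∀ k c → sumF {k} (λ _ → c) ≡ k * c
sumF-const zero    c = refl
sumF-const (suc k) c = cong (c +_) (sumF-const k c)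

sumF-1 : ∀ k → sumF {k} (λ _ → 1) ≡ k
sumF-1 k = trans (sumF-const k 1) (*-identityʳ k)

sumF-+ : (f g : Fin k → ℕ) → sumF (λ i → f i + g i) ≡ sumF f + sumF g
sumF-+ {zero}  f g = refl
sumF-+ {suc k} f g rewrite sumF-+ (f ∘ suc) (g ∘ suc) =
  interchange (f zero) (g zero) (sumF (f ∘ suc)) (sumF (g ∘ suc))
  where
  interchange : ∀ a b c d → (a + b) + (c + d) ≡ (a + c) + (b + d)
  interchange = solve-∀

sumF-mono : {f g : Fin k → ℕ} → (∀ i → f i ≤ g i) → sumF f ≤ sumF g
sumF-mono {zero}  le = z≤n
sumF-mono {suc k} le = +-mono-≤ (le zero) (sumF-mono (le ∘ suc))

sumF-swap : (M : Fin k → Fin l → ℕ) →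
  sumF (λ i → sumF (M i)) ≡ sumF (λ j → sumF (λ i → M i j))
sumF-swap {zero} {l} M = sym (sumF-0 {l} (λ _ → refl))
sumF-swap {suc k} M = trans (cong (sumF (M zero) +_) (sumF-swap (M ∘ suc)))
  (sym (sumF-+ (M zero) (λ j → sumF (λ i → M (suc i) j))))

sumF-only : {f : Fin k → ℕ} (i : Fin k) → (∀ j → j ≢ i → f j ≡ 0) → sumF f ≡ f i
sumF-only {f = f} zero off =
  trans (cong (f zero +_) (sumF-0 (λ j → off (suc j) λ ()))) (+-identityʳ _)
sumF-only {f = f} (suc i) off = cong₂ _+_ (off zero λ ())
  (sumF-only i λ j ne → off (suc j) (ne ∘ suc-injective))

sumF-two : {f : Fin k → ℕ} {i j : Fin k} → i ≢ j →
  (∀ l → l ≢ i → l ≢ j → f l ≡ 0) → sumF f ≡ f i + f j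
sumF-two {f = f} {i} {j} i≢j off = trans (sumF-cong split)
  (trans (sumF-+ at-i at-j) (cong₂ _+_
    (trans (sumF-only i (λ l ne → cong (if_then f l else 0) (is-≢ ne)))
           (cong (if_then f i else 0) (is-refl i)))
    (trans (sumF-only j (λ l ne → cong (if_then f l else 0) (is-≢ ne)))
           (cong (if_then f j else 0) (is-refl j)))))
  where
  at-i at-j : Fin _ → ℕ
  at-i l = if is i l then f l else 0
  at-j l = if is j l then f l else 0
  split : ∀ l → f l ≡ at-i l + at-j l
  split l with l F.≟ i | l F.≟ j
  ... | yes refl | yes refl = ⊥-elim (i≢j refl)
  ... | yes _ | no _ = sym (+-identityʳ _)
  ... | no _  | yes _ = refl
  ... | no l≢i | no l≢j = off l l≢i l≢j

-- Double counting. With `M` supported on the graph of a (partial) bijection it becomes reindexing,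
-- which is how it is applied.
sumF-match : (f : Fin k → ℕ) (g : Fin l → ℕ) (M : Fin k → Fin l → ℕ) →
  (∀ i → sumF (M i) ≡ f i) → (∀ j → sumF (λ i → M i j) ≡ g j) → sumF f ≡ sumF g
sumF-match f g M rows cols =
  trans (sym (sumF-cong rows)) (trans (sumF-swap M) (sumF-cong cols))

size-≤ : {S S′ : Subset k} → (∀ x → S x ≡ true → S′ x ≡ true) → size S ≤ size S′
size-≤ {S = S} {S′} sub = sumF-mono le
  where
  le : ∀ x → 𝟙 (S x) ≤ 𝟙 (S′ x)
  le x with S x | S′ x | sub x
  ... | false | _     | _ = z≤n
  ... | true  | true  | _ = ≤-refl
  ... | true  | false | h with h refl
  ... | ()

size-cong : {S S′ : Subset k} → (∀ x → S x ≡ S′ x) → size S ≡ size S′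
size-cong eq = sumF-cong (λ x → cong 𝟙 (eq x))

size-all : {S : Subset k} → (∀ x → S x ≡ true) → size S ≡ k
size-all {k} all = trans (size-cong all) (sumF-1 k)

size-≤-k : (S : Subset k) → size S ≤ k
size-≤-k S = subst (size S ≤_) (size-all (λ _ → refl)) (size-≤ {S = S} {λ _ → true} (λ _ _ → refl))

size-< : {S S′ : Subset k} → (∀ x → S x ≡ true → S′ x ≡ true) →
  ∀ x → S x ≡ false → S′ x ≡ true → size S < size S′
size-< {S = S} {S′} sub x Sx S′x =
  subst (_≤ size S′) (trans (sumF-+ (𝟙 ∘ is x) (𝟙 ∘ S)) (cong (_+ size S) one)) (sumF-mono le)
  where
  one : sumF (𝟙 ∘ is x) ≡ 1
  one = trans (sumF-only x (λ j ne → cong 𝟙 (is-≢ ne))) (cong 𝟙 (is-refl x))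
  le : ∀ y → 𝟙 (is x y) + 𝟙 (S y) ≤ 𝟙 (S′ y)
  le y with y F.≟ x
  ... | yes refl rewrite Sx | S′x = ≤-refl
  ... | no _ with S y | S′ y | sub y
  ... | false | _     | _ = z≤n
  ... | true  | true  | _ = ≤-refl
  ... | true  | false | h with h refl
  ... | ()

size-≥1 : {S : Subset k} → ∀ x → S x ≡ true → 1 ≤ size S
size-≥1 {k} {S} x Sx = subst (_< size S) (sumF-0 {k} (λ _ → refl))
  (size-< {k} {S = λ _ → false} (λ _ ()) x refl Sx)

size-≥2 : {S : Subset k} → ∀ x y → x ≢ y → S x ≡ true → S y ≡ true → 2 ≤ size S
size-≥2 {S = S} x y x≢y Sx Sy = ≤-trans (s≤s (size-≥1 x (is-refl x)))
  (size-< {S = is x} (λ z eq → subst (λ w → S w ≡ true) (sym (is-true eq)) Sx)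
    y (is-≢ (x≢y ∘ sym)) Sy)

-- Connectivity by colourings

module _ (H : Gr) (P : V H → Set) where

  Mono : (V H → Bool) → Set
  Mono c = ∀ e → P (proj₁ (ends H e)) → P (proj₂ (ends H e)) →
    c (proj₁ (ends H e)) ≡ c (proj₂ (ends H e))

  Conn : Set
  Conn = ∀ c → Mono c → ∀ x y → P x → P y → c x ≡ c y

  Cut : Set
  Cut = Σ[ c ∈ (V H → Bool) ] Mono c ×
    Σ[ x ∈ V H ] Σ[ y ∈ V H ] (P x × P y × c x ≡ true × c y ≡ false)

connected⇒conn : ∀ {H P} → ConnectedOn H P → Conn H P
connected⇒conn {H} {P} con c mono x y px py = go (con x y px py)
  where
  go : ∀ {x y} → Star (Adj H P) x y → c x ≡ c y
  go ε = refl
  go ((px , pz , e , inj₁ (refl , refl)) ◅ w) = trans (mono e px pz) (go w)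
  go ((px , pz , e , inj₂ (refl , refl)) ◅ w) = trans (sym (mono e pz px)) (go w)

conn-resp : ∀ {H} {P Q : V H → Set} →
  (∀ {x} → P x → Q x) → (∀ {x} → Q x → P x) → Conn H P → Conn H Q
conn-resp to from con c mono x y qx qy =
  con c (λ e p p′ → mono e (to p) (to p′)) x y (from qx) (from qy)

cut⇒¬conn : ∀ {H P} → Cut H P → ¬ Conn H P
cut⇒¬conn (c , mono , x , y , px , py , cx , cy) con
  with trans (sym cx) (trans (con c mono x y px py) cy)
... | ()

-- Abstracts over the edge type, which is `Fin m` for a graph and a subtype of it after a deletion.
Searchable : Set → Set₁
Searchable E = {Q : E → Set} → (∀ e → Dec (Q e)) → Dec (∃ Q)

graph : {E : Set} → (E → Fin k × Fin k) → Gr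
graph {k} {E} f = record { V = Fin k ; E = E ; ends = f }

module Search {k} {E : Set} (ends : E → Fin k × Fin k) (search : Searchable E)
  {P : Fin k → Set} (P? : ∀ x → Dec (P x)) where

  H : Gr
  H = graph ends

  Reached : Fin k → Subset k → Set
  Reached x R = R x ≡ true × (∀ y → R y ≡ true → P y × Star (Adj H P) x y)

  Crossing : Subset k → E → Set
  Crossing R e = P (proj₁ (ends e)) × P (proj₂ (ends e)) × R (proj₁ (ends e)) ≢ R (proj₂ (ends e))

  crossing? : ∀ R e → Dec (Crossing R e)
  crossing? R e = P? _ ×-dec (P? _ ×-dec ¬? (_ 𝔹.≟ _))

  extend : ∀ {x R} → Reached x R → ∀ {y z} → R y ≡ true → R z ≡ false → Adj H P y z →
    Σ[ R′ ∈ Subset k ] Reached x R′ × size R < size R′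
  extend {x} {R} (Rx , reach) {y} {z} Ry Rz adj = R′ , (R⊆R′ x Rx , reach′) , size-< R⊆R′ z Rz R′z
    where
    R′ : Subset k
    R′ w = R w ∨ is z w
    R⊆R′ : ∀ w → R w ≡ true → R′ w ≡ true
    R⊆R′ w eq rewrite eq = refl
    R′z : R′ z ≡ true
    R′z rewrite Rz = is-refl z
    reach′ : ∀ w → R′ w ≡ true → P w × Star (Adj H P) x w
    reach′ w eq with R w in Rw
    ... | true = reach w Rw
    ... | false with is-true {i = z} {w} eq
    ... | refl = proj₁ (proj₂ adj) , proj₂ (reach y Ry) ◅◅ (adj ◅ ε)

  -- Every crossing edge enlarges the reached set, whose size is at most `k`. When none is left, `R`
  -- is a component, and its indicator is a `Mono` colouring.
  closure : ∀ {x} fuel R → Reached x R → k ≤ fuel + size R →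
    Σ[ R′ ∈ Subset k ] Reached x R′ × Mono H P R′
  closure {x} fuel R r bound with search (crossing? R)
  ... | no none = R , r , mono
    where
    mono : Mono H P R
    mono e p q with R (proj₁ (ends e)) 𝔹.≟ R (proj₂ (ends e))
    ... | yes eq = eq
    ... | no ne = ⊥-elim (none (e , p , q , ne))
  ... | yes (e , p , q , ne) = continue fuel bound (grow _ refl _ refl)
    where
    grow : ∀ b → R (proj₁ (ends e)) ≡ b → ∀ b′ → R (proj₂ (ends e)) ≡ b′ →
      Σ[ R′ ∈ Subset k ] Reached x R′ × size R < size R′
    grow true  eq true  eq′ = ⊥-elim (ne (trans eq (sym eq′)))
    grow false eq false eq′ = ⊥-elim (ne (trans eq (sym eq′)))
    grow true  eq false eq′ = extend r eq eq′ (p , q , e , inj₁ (refl , refl))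
    grow false eq true  eq′ = extend r eq′ eq (q , p , e , inj₂ (refl , refl))
    continue : ∀ fuel → k ≤ fuel + size R → (Σ[ R′ ∈ Subset k ] Reached x R′ × size R < size R′) →
      Σ[ R′ ∈ Subset k ] Reached x R′ × Mono H P R′
    continue zero    bound (R′ , r′ , lt) = ⊥-elim (<⇒≱ lt (≤-trans (size-≤-k R′) bound))
    continue (suc f) bound (R′ , r′ , lt) = closure f R′ r′
      (≤-trans bound (subst (_≤ f + size R′) (+-suc f (size R)) (+-monoʳ-≤ f lt)))

  reachable : ∀ x → P x → Σ[ R ∈ Subset k ] Reached x R × Mono H P R
  reachable x px = closure k (is x) (is-refl x , start) (m≤m+n k _)
    where
    start : ∀ y → is x y ≡ true → P y × Star (Adj H P) x y
    start y eq with is-true {i = x} {y} eq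
    ... | refl = px , ε

  cutFrom? : ∀ x → P x → (∀ y → P y → Star (Adj H P) x y) ⊎ Cut H P
  cutFrom? x px with reachable x px
  ... | R , (Rx , reach) , mono with any? (λ y → P? y ×-dec R y 𝔹.≟ false)
  ... | yes (y , py , Ry) = inj₂ (R , mono , x , y , px , py , Rx , Ry)
  ... | no none = inj₁ all
    where
    all : ∀ y → P y → Star (Adj H P) x y
    all y py with R y in eq
    ... | true = proj₂ (reach y eq)
    ... | false = ⊥-elim (none (y , py , eq))

  HasCut : Fin k → Set
  HasCut x = P x × Cut H P

  hasCut? : ∀ x → HasCut x ⊎ (P x → ∀ y → P y → Star (Adj H P) x y)
  hasCut? x with P? x
  ... | no ¬p = inj₂ (λ p → ⊥-elim (¬p p))
  ... | yes p with cutFrom? x p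
  ... | inj₁ s = inj₂ (λ _ → s)
  ... | inj₂ c = inj₁ (p , c)

  connected⊎cut : ConnectedOn H P ⊎ Cut H P
  connected⊎cut with choose hasCut?
  ... | inj₁ (_ , _ , cut) = inj₂ cut
  ... | inj₂ all = inj₁ (λ x y px py → all x px y py)

  conn⇒connected : Conn H P → ConnectedOn H P
  conn⇒connected con with connected⊎cut
  ... | inj₁ c = c
  ... | inj₂ cut = ⊥-elim (cut⇒¬conn cut con)

  conn⊎cut : Conn H P ⊎ Cut H P
  conn⊎cut with connected⊎cut
  ... | inj₁ c = inj₁ (connected⇒conn c)
  ... | inj₂ cut = inj₂ cut

-- Two-connectivity in terms of colourings

record TC (G : MGraph) : Set where
  field
    loopFree : LoopFree G
    distinct : Σ[ x ∈ Fin (n G) ] Σ[ y ∈ Fin (n G) ] x ≢ y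
    whole    : Conn (toGr G) (λ _ → ⊤)
    minus    : ∀ v → Conn (toGr G) (_≢ v)

In Out : Subset k → Fin k → Set
In  S x = S x ≡ true
Out S x = S x ≡ false

InMinus : Subset k → Fin k → Fin k → Set
InMinus S v x = S x ≡ true × x ≢ v

-- `minus` ranges over all vertices of `G`; for `v` outside `S` it restates `whole`. This spares a
-- membership proof whenever a vertex is removed.
record Ind (G : MGraph) (S : Subset (n G)) : Set where
  field
    distinct : Σ[ x ∈ Fin (n G) ] Σ[ y ∈ Fin (n G) ] (x ≢ y × S x ≡ true × S y ≡ true)
    whole    : Conn (toGr G) (In S)
    minus    : ∀ v → Conn (toGr G) (InMinus S v)

Good : (G : MGraph) → Subset (n G) → Set
Good G S = (∃[ x ] S x ≡ false) × Ind G S × Conn (toGr G) (Out S)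

searchFin : Searchable (Fin k)
searchFin = any?

searchΣ : {Q : Fin k → Bool} → Searchable (Σ[ f ∈ Fin k ] T (Q f))
searchΣ {Q = Q} {R} R? with any? {P = λ f → Σ[ p ∈ T (Q f) ] R (f , p)} dec
  where
  dec : ∀ f → Dec (Σ[ p ∈ T (Q f) ] R (f , p))
  dec f with 𝔹.T? (Q f)
  ... | no ¬p = no (¬p ∘ proj₁)
  ... | yes p with R? (f , p)
  ... | yes r = yes (p , r)
  ... | no ¬r = no λ { (p′ , r) → ¬r (subst (λ q → R (f , q)) (T-irrelevant p′ p) r) }
... | yes (f , p , r) = yes ((f , p) , r)
... | no none = no λ { ((f , p) , r) → none (f , p , r) }

_≢?_ : (x y : Fin k) → Dec (x ≢ y)
x ≢? y = ¬? (x F.≟ y)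

twoConn⇒TC : ∀ {G} → TwoConn (toGr G) → TC G
twoConn⇒TC (lf , d , w , m) = record
  { loopFree = lf ; distinct = d ; whole = connected⇒conn w
  ; minus = λ v → connected⇒conn (m v) }

TC⇒twoConn : ∀ {G} → TC G → TwoConn (toGr G)
TC⇒twoConn {G} tc = loopFree , distinct
  , Search.conn⇒connected (endsG G) searchFin (λ _ → yes tt) whole
  , λ v → Search.conn⇒connected (endsG G) searchFin (_≢? v) (minus v)
  where open TC tc

module _ {G : MGraph} {S : Subset (n G)} where

  induced⇒ind : TwoConn (induced G S) → Ind G S
  induced⇒ind (_ , ((x , p) , (y , q) , ne) , con , conm) = record
    { distinct = x , y , (λ { refl → ne (cong (x ,_) (T-irrelevant p q)) }) , T⇒≡ p , T⇒≡ q
    ; whole = whole ; minus = minus }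
    where
    whole : Conn (toGr G) (In S)
    whole c mono x y Sx Sy = connected⇒conn con (c ∘ proj₁)
      (λ { (e , p , q) _ _ → mono e (T⇒≡ p) (T⇒≡ q) }) (x , ≡⇒T Sx) (y , ≡⇒T Sy) tt tt
    minus : ∀ v → Conn (toGr G) (InMinus S v)
    minus v with S v in eq
    ... | false = conn-resp {P = In S}
      (λ Sx → Sx , λ { refl → true≢false Sx eq }) proj₁ whole
    ... | true = λ c mono x y Sx Sy → connected⇒conn (conm v′) (c ∘ proj₁)
      (λ { (e , p , q) a b → mono e (T⇒≡ p , off a) (T⇒≡ q , off b) })
      (x , ≡⇒T (proj₁ Sx)) (y , ≡⇒T (proj₁ Sy))
      (proj₂ Sx ∘ cong proj₁) (proj₂ Sy ∘ cong proj₁)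
      where
      v′ : V (induced G S)
      v′ = v , ≡⇒T eq
      off : ∀ {x p} → (x , p) ≢ v′ → x ≢ v
      off ne refl = ne (cong (v ,_) (T-irrelevant _ _))

  liftStar : {P : Fin (n G) → Set} {Q : V (induced G S) → Set} →
    (∀ {x} → P x → S x ≡ true) → (∀ {x} (p : T (S x)) → P x → Q (x , p)) →
    ∀ {x y} → Star (Adj (toGr G) P) x y →
    (p : T (S x)) (q : T (S y)) → Star (Adj (induced G S) Q) (x , p) (y , q)
  liftStar {P} {Q} P⊆S P⇒Q = go
    where
    go : ∀ {x y} → Star (Adj (toGr G) P) x y →
      (p : T (S x)) (q : T (S y)) → Star (Adj (induced G S) Q) (x , p) (y , q)
    go ε p q rewrite T-irrelevant p q = ε
    go ((px , pz , e , inj₁ (refl , refl)) ◅ w) p q =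
      (P⇒Q p px , P⇒Q p′ pz , (e , p , p′) , inj₁ (refl , refl)) ◅ go w p′ q
      where p′ = ≡⇒T (P⊆S pz)
    go ((px , pz , e , inj₂ (refl , refl)) ◅ w) p q =
      (P⇒Q p px , P⇒Q p′ pz , (e , p′ , p) , inj₂ (refl , refl)) ◅ go w p′ q
      where p′ = ≡⇒T (P⊆S pz)

  ind⇒induced : LoopFree G → Ind G S → TwoConn (induced G S)
  ind⇒induced lf ind = (λ { (e , p , q) eq → lf e (cong proj₁ eq) })
    , (let x , y , ne , Sx , Sy = Ind.distinct ind in
       (x , ≡⇒T Sx) , (y , ≡⇒T Sy) , ne ∘ cong proj₁)
    , (λ { (x , p) (y , q) _ _ → liftStar {P = In S} id (λ _ _ → tt)
           (Search.conn⇒connected (endsG G) searchFin (λ x → S x 𝔹.≟ true) (Ind.whole ind)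
             x y (T⇒≡ p) (T⇒≡ q)) p q })
    , λ { (v , _) (x , p) (y , q) x≢v y≢v →
           liftStar {P = InMinus S v} proj₁ (λ _ Px → proj₂ Px ∘ cong proj₁)
           (Search.conn⇒connected (endsG G) searchFin
             (λ x → (S x 𝔹.≟ true) ×-dec (x ≢? v)) (Ind.minus ind v)
             x y (T⇒≡ p , λ { refl → x≢v (cong (v ,_) (T-irrelevant _ _)) })
                 (T⇒≡ q , λ { refl → y≢v (cong (v ,_) (T-irrelevant _ _)) })) p q }

-- Contractions

-- The shape of `qmap` forbids a direct case split on `S x`, because its second
-- argument mentions `S x` in its type; this record lets both be abstracted together.
record Below {X : Set} (R : X ⊎ ⊤ → Set) {b : Bool} (f : T (not b) → X) : Set where
  constructor below
  field at : ∀ p → R (inj₁ (f p))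

module _ {G : MGraph} {S : Subset (n G)} where

  qmap-below : ∀ x (R : QV G S → Set) →
    Below R {S x} (λ p → x , p) → (S x ≡ true → R (inj₂ tt)) → R (qmap G S x)
  qmap-below x R with S x | (λ (p : T (not (S x))) → _,_ {B = λ x → T (not (S x))} x p)
  ... | true  | f = λ _ h → h refl
  ... | false | f = λ o _ → Below.at o tt

  qmap-elim : ∀ x (R : QV G S → Set) →
    (∀ p → R (inj₁ (x , p))) → (S x ≡ true → R (inj₂ tt)) → R (qmap G S x)
  qmap-elim x R out = qmap-below x R (below out)

  qmap-in : ∀ {x} → S x ≡ true → qmap G S x ≡ inj₂ tt
  qmap-in {x} Sx = qmap-elim x (_≡ inj₂ tt)
    (λ p → ⊥-elim (true≢false Sx (Equivalence.to T-not-≡ p))) (λ _ → refl)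

  qmap-out : ∀ {x} (p : T (not (S x))) → qmap G S x ≡ inj₁ (x , p)
  qmap-out {x} p = qmap-elim x (_≡ inj₁ (x , p))
    (λ q → cong (λ r → inj₁ (x , r)) (T-irrelevant q p))
    (λ Sx → ⊥-elim (true≢false Sx (Equivalence.to T-not-≡ p)))

  qmap≢tt⇒out : ∀ {x} → qmap G S x ≢ inj₂ tt → S x ≡ false
  qmap≢tt⇒out {x} ne with true⊎false (S x)
  ... | inj₁ eq = ⊥-elim (ne (qmap-in eq))
  ... | inj₂ eq = eq

  out⇒qmap≢tt : ∀ {x} → S x ≡ false → qmap G S x ≢ inj₂ tt
  out⇒qmap≢tt {x} Sx eq with trans (sym (qmap-out (Equivalence.from T-not-≡ Sx))) eq
  ... | ()

  qmap-injective-out : ∀ {x y} → S x ≡ false → qmap G S x ≡ qmap G S y → x ≡ y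
  qmap-injective-out {x} {y} Sx eq with true⊎false (S y)
  ... | inj₁ Sy = ⊥-elim (out⇒qmap≢tt Sx (trans eq (qmap-in Sy)))
  ... | inj₂ Sy = cong proj₁ (inj₁-injective
    (trans (sym (qmap-out {x} (Equivalence.from T-not-≡ Sx)))
      (trans eq (qmap-out {y} (Equivalence.from T-not-≡ Sy)))))

  contractSet⇒conn : TwoConn (contractSet G S) → Conn (toGr G) (Out S)
  contractSet⇒conn (_ , _ , _ , con) c mono x y Sx Sy =
    subst₂ _≡_ (value x Sx) (value y Sy)
      (connected⇒conn (con (inj₂ tt)) colour colour-mono
        (qmap G S x) (qmap G S y) (out⇒qmap≢tt Sx) (out⇒qmap≢tt Sy))
    where
    colour : QV G S → Bool
    colour (inj₁ (x , _)) = c x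
    -- Any value will do at the contracted vertex, since it is the vertex that gets removed.
    colour (inj₂ _) = true
    value : ∀ x → S x ≡ false → colour (qmap G S x) ≡ c x
    value x Sx = cong colour (qmap-out {x} (Equivalence.from T-not-≡ Sx))
    colour-mono : Mono (contractSet G S) (_≢ inj₂ tt) colour
    colour-mono (e , _) p q = trans (value _ Sp) (trans (mono e Sp Sq) (sym (value _ Sq)))
      where
      Sp = qmap≢tt⇒out p
      Sq = qmap≢tt⇒out q

  module _ (keep : Fin (m G) → Bool) (tc : TC G)
    (dropped-inside : ∀ e → keep e ≡ false →
       S (proj₁ (endsG G e)) ≡ true × S (proj₂ (endsG G e)) ≡ true)
    (kept-not-inside : ∀ e → keep e ≡ true →
       ¬ (S (proj₁ (endsG G e)) ≡ true × S (proj₂ (endsG G e)) ≡ true))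
    (inhabited : ∃[ z ] S z ≡ true) (proper : ∃[ x ] S x ≡ false)
    (outside : Conn (toGr G) (Out S)) where

    private
      Q : Gr
      Q = quot G S keep

    -- An edge dropped by `keep` has both ends in `S`, so its image is a step that stays at the
    -- contracted vertex.
    pushStar : {R : QV G S → Set} → ∀ {x y} → Star (Adj (toGr G) (R ∘ qmap G S)) x y →
      Star (Adj Q R) (qmap G S x) (qmap G S y)
    pushStar ε = ε
    pushStar ((px , pz , e , ue) ◅ w) with keep e in eq
    pushStar ((px , pz , e , inj₁ (refl , refl)) ◅ w) | true =
      (px , pz , (e , ≡⇒T eq) , inj₁ (refl , refl)) ◅ pushStar w
    pushStar ((px , pz , e , inj₂ (refl , refl)) ◅ w) | true =
      (px , pz , (e , ≡⇒T eq) , inj₂ (refl , refl)) ◅ pushStar w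
    pushStar {R} {y = y} ((px , pz , e , inj₁ (refl , refl)) ◅ w) | false =
      subst (λ q → Star (Adj Q R) q (qmap G S y))
        (let a , b = dropped-inside e eq in trans (qmap-in b) (sym (qmap-in a))) (pushStar w)
    pushStar {R} {y = y} ((px , pz , e , inj₂ (refl , refl)) ◅ w) | false =
      subst (λ q → Star (Adj Q R) q (qmap G S y))
        (let a , b = dropped-inside e eq in trans (qmap-in a) (sym (qmap-in b))) (pushStar w)

    qmap-surjective : ∀ q → ∃[ x ] qmap G S x ≡ q
    qmap-surjective (inj₁ (x , p)) = x , qmap-out p
    qmap-surjective (inj₂ tt) = proj₁ inhabited , qmap-in (proj₂ inhabited)

    pushConn : {R : QV G S → Set} → (∀ x → Dec (R (qmap G S x))) →
      Conn (toGr G) (R ∘ qmap G S) → ConnectedOn Q R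
    pushConn R? con q r Rq Rr with qmap-surjective q | qmap-surjective r
    ... | x , refl | y , refl =
      pushStar (Search.conn⇒connected (endsG G) searchFin R? con x y Rq Rr)

    -- Removing the contracted vertex leaves the complement of `S`; removing any other vertex leaves
    -- an image of `G` minus that vertex. An abstract `keep` covers both contractions: `contractSet`
    -- drops all edges inside `S`, `contractEdge` only one, which is the same if that edge has no
    -- parallel.
    quot-twoConn : TwoConn Q
    quot-twoConn = noLoop
      , (qmap G S (proj₁ proper) , inj₂ tt , out⇒qmap≢tt (proj₂ proper))
      , pushConn (λ _ → yes tt) (TC.whole tc)
      , remove
      where
      noLoop : ∀ e → proj₁ (ends Q e) ≢ proj₂ (ends Q e)
      noLoop (e , p) eq with true⊎false (S (proj₁ (endsG G e)))
      ... | inj₂ a = TC.loopFree tc e (qmap-injective-out a eq)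
      ... | inj₁ a with true⊎false (S (proj₂ (endsG G e)))
      ... | inj₂ b = TC.loopFree tc e (sym (qmap-injective-out b (sym eq)))
      ... | inj₁ b = kept-not-inside e (T⇒≡ p) (a , b)
      remove : ∀ v → ConnectedOn Q (_≢ v)
      remove (inj₂ tt) = pushConn dec
        (conn-resp {P = Out S} out⇒qmap≢tt qmap≢tt⇒out outside)
        where
        dec : ∀ x → Dec (qmap G S x ≢ inj₂ tt)
        dec x with true⊎false (S x)
        ... | inj₁ eq = no (λ ne → ne (qmap-in eq))
        ... | inj₂ eq = yes (out⇒qmap≢tt eq)
      remove (inj₁ (v , p)) = pushConn dec (conn-resp {P = _≢ v} to from (TC.minus tc v))
        where
        to : ∀ {x} → x ≢ v → qmap G S x ≢ inj₁ (v , p)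
        to ne eq = ne (sym (qmap-injective-out (Equivalence.to T-not-≡ p)
          (trans (qmap-out p) (sym eq))))
        from : ∀ {x} → qmap G S x ≢ inj₁ (v , p) → x ≢ v
        from ne refl = ne (qmap-out p)
        dec : ∀ x → Dec (qmap G S x ≢ inj₁ (v , p))
        dec x with x F.≟ v
        ... | yes refl = no (λ ne → ne (qmap-out p))
        ... | no ne = yes (to ne)

module _ {G : MGraph} (tc : TC G) {S : Subset (n G)} where

  goodFlat⇒good : GoodFlat G S → Good G S
  goodFlat⇒good (x , ind , con) = x , induced⇒ind ind , contractSet⇒conn con

  good⇒goodFlat : Good G S → GoodFlat G S
  good⇒goodFlat (x , ind , con) = x , ind⇒induced (TC.loopFree tc) ind
    , quot-twoConn _ tc
        (λ e eq → ∧-true (not-false eq))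
        (λ e eq (a , b) → true≢false (cong₂ _∧_ a b) (not-true eq))
        (let z , _ , _ , Sz , _ = Ind.distinct ind in z , Sz) x con

-- Deletion and contraction of an edge

Link : (G : MGraph) → Fin (n G) → Fin (n G) → Set
Link G x y = Σ[ e ∈ Fin (m G) ] UEq (endsG G e) (x , y)

link-sym : ∀ {G x y} → Link G x y → Link G y x
link-sym (e , inj₁ (p , q)) = e , inj₂ (p , q)
link-sym (e , inj₂ (p , q)) = e , inj₁ (p , q)

edge-link : ∀ G e → Link G (proj₁ (endsG G e)) (proj₂ (endsG G e))
edge-link G e = e , inj₁ (refl , refl)

mono-link : ∀ {G P c x y} → Mono (toGr G) P c → Link G x y → P x → P y → c x ≡ c y
mono-link mono (e , inj₁ (refl , refl)) px py = mono e px py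
mono-link mono (e , inj₂ (refl , refl)) px py = sym (mono e py px)

mono-not : ∀ {H P c} → Mono H P c → Mono H P (not ∘ c)
mono-not mono e p q = cong not (mono e p q)

-- Every vertex of K reaches u in G − v without leaving K before, so a colouring
-- that is constant along the edges at K takes the value d u on K.
attached : ∀ {G} {K : Subset (n G)} {d : Fin (n G) → Bool} {u v x} →
  Conn (toGr G) (_≢ v) → u ≢ v → K u ≡ false → K v ≡ false →
  (∀ {y z} → Link G y z → K y ≡ true → z ≢ v → d y ≡ d z × (K z ≡ true ⊎ z ≡ u)) →
  K x ≡ true → d x ≡ d u
attached {G} {K} {d} {u} {v} {x} con u≢v Ku Kv closed Kx =
  trans (sym (value x Kx)) (trans (con d′ mono x u x≢v u≢v) (value-out u Ku))
  where
  d′ : Fin (n G) → Bool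
  d′ z = if K z then d z else d u
  value : ∀ z → K z ≡ true → d′ z ≡ d z
  value z Kz rewrite Kz = refl
  value-out : ∀ z → K z ≡ false → d′ z ≡ d u
  value-out z Kz rewrite Kz = refl
  x≢v : x ≢ v
  x≢v refl = true≢false Kx Kv
  half : ∀ {y z} → Link G y z → K y ≡ true → z ≢ v → d′ y ≡ d′ z
  half {y} {z} l Ky z≢v with closed l Ky z≢v
  ... | eq , inj₁ Kz = trans (value y Ky) (trans eq (sym (value z Kz)))
  ... | eq , inj₂ refl = trans (value y Ky) (trans eq (sym (value-out u Ku)))
  mono : Mono (toGr G) (_≢ v) d′
  mono e p q with true⊎false (K (proj₁ (endsG G e))) | true⊎false (K (proj₂ (endsG G e)))
  ... | inj₁ a | _ = half (edge-link G e) a q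
  ... | inj₂ a | inj₁ b = sym (half (link-sym {G} (edge-link G e)) b p)
  ... | inj₂ a | inj₂ b = trans (value-out _ a) (sym (value-out _ b))

pair : Fin k → Fin k → Subset k
pair u v x = is u x ∨ is v x

pair-l : (u v : Fin k) → pair u v u ≡ true
pair-l u v rewrite is-refl u = refl

pair-r : (u v : Fin k) → pair u v v ≡ true
pair-r u v rewrite is-refl v with is u v
... | true = refl
... | false = refl

pair-cases : (u v x : Fin k) → pair u v x ≡ true → x ≡ u ⊎ x ≡ v
pair-cases u v x eq with ∨-true {is u x} eq
... | inj₁ p = inj₁ (is-true p)
... | inj₂ p = inj₂ (is-true p)

pair-out : (u v x : Fin k) → pair u v x ≡ false → x ≢ u × x ≢ v
pair-out u v x eq with ∨-false {is u x} eq
... | p , q = is-false p , is-false q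

pair-out⁻ : {u v x : Fin k} → x ≢ u → x ≢ v → pair u v x ≡ false
pair-out⁻ {u = u} {v} {x} p q rewrite is-≢ p | is-≢ q = refl

other : 2 ≤ k → (i : Fin k) → ∃[ j ] j ≢ i
other (s≤s (s≤s _)) zero    = suc zero , λ ()
other (s≤s (s≤s _)) (suc i) = zero , λ ()

module DeleteContract {G : MGraph} (tc : TC G) (f : Fin (m G)) where

  open TC tc

  u v : Fin (n G)
  u = proj₁ (endsG G f)
  v = proj₂ (endsG G f)

  S : Subset (n G)
  S = pair u v

  u≢v : u ≢ v
  u≢v = loopFree f

  mono-delete : ∀ {P d} → (P u → P v → d u ≡ d v) → Mono (delete G f) P d → Mono (toGr G) P d
  mono-delete uv mono e p q with e F.≟ f
  ... | yes refl = uv p q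
  ... | no ne = mono (e , ≡⇒T (cong not (is-≢ ne))) p q

  delete-link : ∀ {P d y z} → S y ≡ false → Mono (delete G f) P d →
    Link G y z → P y → P z → d y ≡ d z
  delete-link Sy mono (e , ue) py pz with e F.≟ f
  delete-link Sy mono (e , inj₁ (refl , refl)) py pz | yes refl = ⊥-elim (proj₁ (pair-out u v _ Sy) refl)
  delete-link Sy mono (e , inj₂ (refl , refl)) py pz | yes refl = ⊥-elim (proj₂ (pair-out u v _ Sy) refl)
  delete-link Sy mono (e , inj₁ (refl , refl)) py pz | no ne = mono (e , ≡⇒T (cong not (is-≢ ne))) py pz
  delete-link Sy mono (e , inj₂ (refl , refl)) py pz | no ne = sym (mono (e , ≡⇒T (cong not (is-≢ ne))) pz py)

  -- A colouring that agrees at `u` and `v` is constant along `f` as well, so the connectivity of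
  -- `G` applies to it. If the removed vertex is an end of `f`, nothing has to be checked.
  delete-twoConn :
    (∀ d → Mono (delete G f) (λ _ → ⊤) d → d u ≡ d v) →
    (∀ w d → u ≢ w → v ≢ w → Mono (delete G f) (_≢ w) d → d u ≡ d v) →
    TwoConn (delete G f)
  delete-twoConn uv uv-minus = (λ { (e , _) → loopFree e }) , distinct
    , Search.conn⇒connected _ searchΣ (λ _ → yes tt)
        (λ d mono → whole d (mono-delete {λ _ → ⊤} {d} (λ _ _ → uv d mono) mono))
    , λ w → Search.conn⇒connected _ searchΣ (_≢? w)
        (λ d mono → minus w d (mono-delete {_≢ w} {d} (λ p q → uv-minus w d p q mono) mono))

  -- Let `K` be the part of colour `true` outside `{u , v}`. As `G` minus `v` is connected, `K` is
  -- attached to `u`, and as `G` minus `u` is connected, also to `v`. So `K` carries a connection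
  -- from `u` to `v` that avoids `f`, and it survives in `P`.
  bridge : ∀ {P : Fin (n G) → Set} {c d x} → P u → P v → (∀ {z} → S z ≡ false → c z ≡ true → P z) →
    Mono (toGr G) (Out S) c → S x ≡ false → c x ≡ true →
    Mono (delete G f) P d → d u ≡ d v
  bridge {P} {c} {d} {x} pu pv pK mono-c Sx cx mono-d =
    trans (sym (attached (minus v) u≢v Ku Kv (closed (λ {z} → pair-cases u v z)) Kx))
          (attached (minus u) (u≢v ∘ sym) Kv Ku (closed (λ {z} → swap ∘ pair-cases u v z)) Kx)
    where
    K : Subset (n G)
    K z = not (S z) ∧ c z
    Ku : K u ≡ false
    Ku rewrite pair-l u v = refl
    Kv : K v ≡ false
    Kv rewrite pair-r u v = refl
    K-in : ∀ {z} → S z ≡ false → c z ≡ true → K z ≡ true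
    K-in Sz cz rewrite Sz = cz
    Kx : K x ≡ true
    Kx = K-in Sx cx
    closed : ∀ {a b} → (∀ {z} → S z ≡ true → z ≡ a ⊎ z ≡ b) →
      ∀ {y z} → Link G y z → K y ≡ true → z ≢ b → d y ≡ d z × (K z ≡ true ⊎ z ≡ a)
    closed ab {y} {z} l Ky z≢b with ∧-true {not (S y)} Ky | true⊎false (S z)
    ... | Sy′ , cy | inj₂ Sz = delete-link Sy mono-d l (pK Sy cy) (pK Sz cz) , inj₁ (K-in Sz cz)
      where
      Sy = not-true Sy′
      cz = trans (sym (mono-link {G} mono-c l Sy Sz)) cy
    ... | Sy′ , cy | inj₁ Sz = delete-link Sy mono-d l (pK Sy cy) pz , inj₂ z≡a
      where
      Sy = not-true Sy′
      pz : P z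
      pz with pair-cases u v z Sz
      ... | inj₁ refl = pu
      ... | inj₂ refl = pv
      z≡a : z ≡ _
      z≡a with ab Sz
      ... | inj₁ eq = eq
      ... | inj₂ eq = ⊥-elim (z≢b eq)

  cut⇒delete : Cut (toGr G) (Out S) → TwoConn (delete G f)
  cut⇒delete (c , mono , x , y , Sx , Sy , cx , cy) = delete-twoConn
    (λ d → bridge {λ _ → ⊤} {c} {d} {x} tt tt (λ _ _ → tt) mono Sx cx)
    avoid
    where
    avoid : ∀ w d → u ≢ w → v ≢ w → Mono (delete G f) (_≢ w) d → d u ≡ d v
    -- The removed vertex `w` lies in one colour class only; the other one still links `u` to `v`.
    avoid w d u≢w v≢w with true⊎false (c w)
    ... | inj₂ cw = bridge {_≢ w} {c} {d} {x} u≢w v≢w (λ { _ cz refl → true≢false cz cw }) mono Sx cx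
    ... | inj₁ cw = bridge {_≢ w} {not ∘ c} {d} {y} u≢w v≢w (λ { _ cz refl → true≢false cw (not-true cz) })
      (mono-not {toGr G} {Out S} {c} mono) Sy (cong not cy)

  parallel⇒delete : ∀ g → g ≢ f → S (proj₁ (endsG G g)) ≡ true → S (proj₂ (endsG G g)) ≡ true →
    TwoConn (delete G f)
  parallel⇒delete g g≢f a b = delete-twoConn
    (λ d mono → along d (mono g′ tt tt))
    (λ w d u≢w v≢w mono → along d
      (mono g′ (off w u≢w v≢w {proj₁ (endsG G g)} a) (off w u≢w v≢w {proj₂ (endsG G g)} b)))
    where
    g′ = g , ≡⇒T (cong not (is-≢ g≢f))
    off : ∀ w → u ≢ w → v ≢ w → ∀ {z} → S z ≡ true → z ≢ w
    off w u≢w v≢w {z} Sz refl with pair-cases u v z Sz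
    ... | inj₁ eq = u≢w (sym eq)
    ... | inj₂ eq = v≢w (sym eq)
    along : ∀ (d : Fin (n G) → Bool) → d (proj₁ (endsG G g)) ≡ d (proj₂ (endsG G g)) → d u ≡ d v
    along d eq with pair-cases u v _ a | pair-cases u v _ b
    ... | inj₁ p | inj₁ q = ⊥-elim (loopFree g (trans p (sym q)))
    ... | inj₂ p | inj₂ q = ⊥-elim (loopFree g (trans p (sym q)))
    ... | inj₁ p | inj₂ q = subst₂ (λ x y → d x ≡ d y) p q eq
    ... | inj₂ p | inj₁ q = sym (subst₂ (λ x y → d x ≡ d y) p q eq)

  -- The graphic case of Tutte's theorem on deletion and contraction in connected matroids.
  delete⊎contract : 2 ≤ m G → TwoConn (delete G f) ⊎ TwoConn (contractEdge G f)
  delete⊎contract 2≤m with any? (λ g → (g ≢? f) ×-dec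
      ((S (proj₁ (endsG G g)) 𝔹.≟ true) ×-dec (S (proj₂ (endsG G g)) 𝔹.≟ true)))
  ... | yes (g , g≢f , a , b) = inj₁ (parallel⇒delete g g≢f a b)
  ... | no simple with any? (λ x → S x 𝔹.≟ false)
  -- If `u` and `v` are the only vertices, a second edge is parallel to `f`; this is where `2 ≤ m G`
  -- enters.
  ... | no full = ⊥-elim (let g , g≢f = other 2≤m f in simple (g , g≢f , inside (proj₁ (endsG G g)) , inside (proj₂ (endsG G g))))
    where
    inside : ∀ x → S x ≡ true
    inside x with true⊎false (S x)
    ... | inj₁ eq = eq
    ... | inj₂ eq = ⊥-elim (full (x , eq))
  ... | yes proper with Search.conn⊎cut (endsG G) searchFin (λ x → S x 𝔹.≟ false)
  ... | inj₂ cut = inj₁ (cut⇒delete cut)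
  ... | inj₁ con = inj₂ (quot-twoConn _ tc
      (λ { e eq → subst (λ e → S (proj₁ (endsG G e)) ≡ true × S (proj₂ (endsG G e)) ≡ true)
             (sym (is-true {i = f} (not-false eq))) (pair-l u v , pair-r u v) })
      (λ e eq (a , b) → simple (e , is-false {i = f} (not-true eq) , a , b))
      (u , pair-l u v) proper con)

-- The condition (♠)₂ without weights

edges : (G : MGraph) → Subset (n G) → ℕ
edges G S = size (inE G S)

-- Both equations of the condition with 2 added on each side, which clears the truncated
-- subtraction.
record Tight (G : MGraph) : Set where
  field
    count : m G + 2 ≡ 2 * n G
    tight : ∀ S → Good G S → edges G S + 3 ≡ 2 * size S

2*-pred : ∀ {a} → 1 ≤ a → 2 * (a ∸ 1) + 2 ≡ 2 * a
2*-pred {suc a} _ = lemma a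
  where
  lemma : ∀ a → 2 * a + 2 ≡ 2 * suc a
  lemma = solve-∀

fin≢⇒2≤ : {x y : Fin k} → x ≢ y → 2 ≤ k
fin≢⇒2≤ {k} {x} {y} ne = subst (2 ≤_) (size-all {S = λ _ → true} (λ _ → refl)) (size-≥2 x y ne refl refl)

TC⇒2≤n : ∀ {G} → TC G → 2 ≤ n G
TC⇒2≤n tc = let _ , _ , ne = TC.distinct tc in fin≢⇒2≤ ne

weight≡1 : ∀ {G w} → IsWeight 2 G w → ∀ e → w e ≡ 1
weight≡1 isw e with isw e
... | del , con , inj₁ d = del d
... | del , con , inj₂ c = con c

ind-size : ∀ {G S} → Ind G S → 2 ≤ size S
ind-size ind = let x , y , ne , Sx , Sy = Ind.distinct ind in size-≥2 x y ne Sx Sy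

spade⇒tight : ∀ {G} → TC G → Spade 2 G → Tight G
spade⇒tight {G} tc (w , isw , total , flats) = record { count = count ; tight = tight }
  where
  count : m G + 2 ≡ 2 * n G
  count = trans (cong (_+ 2) (trans (sym (trans (sumF-cong (weight≡1 isw)) (sumF-1 (m G)))) total))
    (2*-pred (≤-trans (s≤s z≤n) (TC⇒2≤n tc)))
  tight : ∀ S → Good G S → edges G S + 3 ≡ 2 * size S
  tight S good@(_ , ind , _) = trans (sym (+-assoc (edges G S) 1 2)) (trans (cong (_+ 2)
    (trans (cong (_+ 1) (sumF-cong weigh)) (flats S (good⇒goodFlat tc good))))
    (2*-pred (≤-trans (s≤s z≤n) (ind-size ind))))
    where
    weigh : ∀ e → 𝟙 (inE G S e) ≡ (if inE G S e then w e else 0)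
    weigh e rewrite weight≡1 isw e = refl

tight⇒2≤m : ∀ {G} → TC G → Tight G → 2 ≤ m G
tight⇒2≤m {G} tc ti = +-cancelʳ-≤ 2 2 (m G) (subst (4 ≤_) (sym (Tight.count ti)) (*-monoʳ-≤ 2 (TC⇒2≤n tc)))

-- The constant weight 1 fits both clauses because `2 ∸ 1` is 1. The remaining clause is
-- `delete⊎contract`, and the count supplies the two edges it asks for.
tight⇒spade : ∀ {G} → TC G → Tight G → Spade 2 G
tight⇒spade {G} tc ti = (λ _ → 1)
  , (λ e → (λ _ → refl) , (λ _ → refl) , DeleteContract.delete⊎contract tc e (tight⇒2≤m tc ti))
  , +-cancelʳ-≡ 2 _ _ (trans (cong (_+ 2) (sumF-1 (m G))) (trans (Tight.count ti)
      (sym (2*-pred (≤-trans (s≤s z≤n) (TC⇒2≤n tc))))))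
  , λ S flat → let good = goodFlat⇒good tc flat in
      +-cancelʳ-≡ 2 _ _ (trans (+-assoc (edges G S) 1 2) (trans (Tight.tight ti S good)
        (sym (2*-pred (≤-trans (s≤s z≤n) (ind-size (proj₁ (proj₂ good))))))))

-- Sparsity

size-modular : (A B C D : Subset k) → (∀ x → C x ≡ A x ∨ B x) → (∀ x → D x ≡ A x ∧ B x) →
  size A + size B ≡ size C + size D
size-modular A B C D union inter =
  trans (sym (sumF-+ (𝟙 ∘ A) (𝟙 ∘ B))) (trans (sumF-cong pointwise) (sumF-+ (𝟙 ∘ C) (𝟙 ∘ D)))
  where
  pointwise : ∀ x → 𝟙 (A x) + 𝟙 (B x) ≡ 𝟙 (C x) + 𝟙 (D x)
  pointwise x rewrite union x | inter x with A x | B x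
  ... | true  | true  = refl
  ... | true  | false = refl
  ... | false | true  = refl
  ... | false | false = refl

-- Q is cut into two parts L and R that meet in the set core, by a colouring of Q ∖ core.
module Split {G : MGraph} (Q core : Subset (n G)) (core⊆Q : ∀ x → core x ≡ true → Q x ≡ true)
  (c : Fin (n G) → Bool) (mono : Mono (toGr G) (λ x → Q x ≡ true × core x ≡ false) c) where

  L R : Subset (n G)
  L x = Q x ∧ (c x ∨ core x)
  R x = Q x ∧ (not (c x) ∨ core x)

  union : ∀ x → Q x ≡ L x ∨ R x
  union x with Q x | c x | core x
  ... | false | _     | _ = refl
  ... | true  | true  | _ = refl
  ... | true  | false | true  = refl
  ... | true  | false | false = refl

  inter : ∀ x → core x ≡ L x ∧ R x
  inter x with Q x | c x | core x | core⊆Q x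
  ... | false | _     | false | _ = refl
  ... | true  | true  | false | _ = refl
  ... | true  | false | false | _ = refl
  ... | true  | true  | true  | _ = refl
  ... | true  | false | true  | _ = refl
  ... | false | _     | true  | h with h refl
  ... | ()

  split-size : size L + size R ≡ size Q + size core
  split-size = size-modular L R Q core union inter

  edge-inter : ∀ e → inE G core e ≡ inE G L e ∧ inE G R e
  edge-inter e = trans (cong₂ _∧_ (inter _) (inter _)) (∧-interchange (L (proj₁ (endsG G e))) _ _ _)

  -- An edge inside `Q` that avoids `core` has ends of one colour, so it stays in one part; an edge
  -- with an end in `core` lies in the part of its other end. The rest is a truth table.
  edge-union : ∀ e → inE G Q e ≡ inE G L e ∨ inE G R e
  edge-union e with mono e
  ... | h with Q (proj₁ (endsG G e)) | Q (proj₂ (endsG G e))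
             | c (proj₁ (endsG G e)) | c (proj₂ (endsG G e))
             | core (proj₁ (endsG G e)) | core (proj₂ (endsG G e))
  ... | false | _     | _     | _     | _     | _     = refl
  ... | true  | false | a     | _     | b     | _ with a ∨ b | not a ∨ b
  ... | true  | true = refl
  ... | true  | false = refl
  ... | false | true = refl
  ... | false | false = refl
  edge-union e | h | true | true | true  | true  | _ | _ = refl
  edge-union e | h | true | true | false | false | true  | true  = refl
  edge-union e | h | true | true | false | false | true  | false = refl
  edge-union e | h | true | true | false | false | false | _     = refl
  edge-union e | h | true | true | true  | false | true  | true  = refl
  edge-union e | h | true | true | true  | false | true  | false = refl
  edge-union e | h | true | true | true  | false | false | true  = refl
  edge-union e | h | true | true | false | true  | true  | _     = refl
  edge-union e | h | true | true | false | true  | false | true  = refl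
  edge-union e | h | true | true | true  | false | false | false with h (refl , refl) (refl , refl)
  ... | ()
  edge-union e | h | true | true | false | true  | false | false with h (refl , refl) (refl , refl)
  ... | ()

  split-edges : edges G L + edges G R ≡ edges G Q + edges G core
  split-edges = size-modular (inE G L) (inE G R) (inE G Q) (inE G core) edge-union edge-inter

  L⊆Q : ∀ x → L x ≡ true → Q x ≡ true
  L⊆Q x = proj₁ ∘ ∧-true {Q x}

  R⊆Q : ∀ x → R x ≡ true → Q x ≡ true
  R⊆Q x = proj₁ ∘ ∧-true {Q x}

  core⊆L : ∀ x → core x ≡ true → L x ≡ true
  core⊆L x eq rewrite core⊆Q x eq | eq with c x
  ... | true = refl
  ... | false = refl

  core⊆R : ∀ x → core x ≡ true → R x ≡ true
  core⊆R x eq rewrite core⊆Q x eq | eq with c x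
  ... | true = refl
  ... | false = refl

  module Parts {x y} (Qx : Q x ≡ true) (Qy : Q y ≡ true) (cx : c x ≡ true) (cy : c y ≡ false)
    (core-x : core x ≡ false) (core-y : core y ≡ false) where

    Lx : L x ≡ true
    Lx rewrite Qx | cx = refl
    Ly : L y ≡ false
    Ly rewrite Qy | cy = core-y
    Rx : R x ≡ false
    Rx rewrite Qx | cx = core-x
    Ry : R y ≡ true
    Ry rewrite Qy | cy = refl
    L<Q : size L < size Q
    L<Q = size-< L⊆Q y Ly Qy
    R<Q : size R < size Q
    R<Q = size-< R⊆Q x Rx Qx

conn⊎cut : ∀ G {P : Fin (n G) → Set} → (∀ x → Dec (P x)) → Conn (toGr G) P ⊎ Cut (toGr G) P
conn⊎cut G = Search.conn⊎cut (endsG G) searchFin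

-- U consists of S and of some connected components of its complement.
module _ {G : MGraph} {S U : Subset (n G)} (S⊆U : ∀ x → S x ≡ true → U x ≡ true)
  (closed : ∀ {x y} → Link G x y → U x ≡ true → U y ≡ false → S x ≡ true) where

  -- A colouring of `U` is continued to the outside by its value at `s`. An edge leaving `U` starts
  -- in `S`, where the colour is constantly that value, so the continued colouring is `Mono` on `P`.
  conn-enlarge : {P : Fin (n G) → Set} → Conn (toGr G) P → (∃[ z ] (S z ≡ true × P z)) →
    Conn (toGr G) (λ x → S x ≡ true × P x) → Conn (toGr G) (λ x → U x ≡ true × P x)
  conn-enlarge {P} con (s , Ss , ps) conS d mono x y (Ux , px) (Uy , py) =
    trans (sym (value x Ux)) (trans (con d′ mono′ x y px py) (value y Uy))
    where
    d′ : Fin (n G) → Bool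
    d′ z = if U z then d z else d s
    value : ∀ z → U z ≡ true → d′ z ≡ d z
    value z Uz rewrite Uz = refl
    value-out : ∀ z → U z ≡ false → d′ z ≡ d s
    value-out z Uz rewrite Uz = refl
    half : ∀ {y z} → Link G y z → P y → P z → U y ≡ true → U z ≡ false → d′ y ≡ d′ z
    half l py pz Uy Uz = trans (value _ Uy) (trans
      (conS d (λ e p q → mono e (S⊆U _ (proj₁ p) , proj₂ p) (S⊆U _ (proj₁ q) , proj₂ q))
        _ s (closed l Uy Uz , py) (Ss , ps)) (sym (value-out _ Uz)))
    mono′ : Mono (toGr G) P d′
    mono′ e p q with true⊎false (U (proj₁ (endsG G e))) | true⊎false (U (proj₂ (endsG G e)))
    ... | inj₁ a | inj₁ b = trans (value _ a) (trans (mono e (a , p) (b , q)) (sym (value _ b)))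
    ... | inj₁ a | inj₂ b = half (edge-link G e) p q a b
    ... | inj₂ a | inj₁ b = sym (half (link-sym {G} (edge-link G e)) q p b a)
    ... | inj₂ a | inj₂ b = trans (value-out _ a) (sym (value-out _ b))

  ind-enlarge : TC G → Ind G S → Ind G U
  ind-enlarge tc ind = record
    { distinct = x , y , x≢y , S⊆U x Sx , S⊆U y Sy
    ; whole = conn-resp {P = λ x → U x ≡ true × ⊤} proj₁ (_, tt)
        (conn-enlarge (TC.whole tc) (x , Sx , tt)
          (conn-resp {P = In S} (_, tt) proj₁ (Ind.whole ind)))
    ; minus = λ v → conn-enlarge (TC.minus tc v) (avoid v) (Ind.minus ind v) }
    where
    x = proj₁ (Ind.distinct ind)
    y = proj₁ (proj₂ (Ind.distinct ind))
    x≢y = proj₁ (proj₂ (proj₂ (Ind.distinct ind)))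
    Sx = proj₁ (proj₂ (proj₂ (proj₂ (Ind.distinct ind))))
    Sy = proj₂ (proj₂ (proj₂ (proj₂ (Ind.distinct ind))))
    avoid : ∀ v → ∃[ z ] (S z ≡ true × z ≢ v)
    avoid v with x F.≟ v
    ... | yes refl = y , Sy , x≢y ∘ sym
    ... | no x≢v = x , Sx , x≢v

module Sparsity {G : MGraph} (tc : TC G) (ti : Tight G) where

  open Tight ti

  -- A dichotomy with a gap of one: either equality, together with the evidence `Extra`, or a bound
  -- better by one. Excluding the second alternative by counting thus yields `Extra` for free.
  Bound : Subset (n G) → Set → Set
  Bound S Extra = (Extra × edges G S + 3 ≡ 2 * size S) ⊎ (edges G S + 4 ≤ 2 * size S)

  bound⇒≤ : ∀ {S Extra} → Bound S Extra → edges G S + 3 ≤ 2 * size S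
  bound⇒≤ (inj₁ (_ , eq)) = ≤-reflexive eq
  bound⇒≤ {S} (inj₂ le) = ≤-trans (+-monoʳ-≤ (edges G S) (s≤s (s≤s (s≤s z≤n)))) le

  edges-all : {Q : Subset (n G)} → (∀ x → Q x ≡ true) → edges G Q ≡ m G
  edges-all all = size-all (λ e → cong₂ _∧_ (all _) (all _))

  sum-bounds : ∀ a b s₁ s₂ {e₁ e₂ e s} → e₁ + a ≤ 2 * s₁ → e₂ + b ≤ 2 * s₂ →
    e₁ + e₂ ≡ e → s₁ + s₂ ≡ s → e + (a + b) ≤ 2 * s
  sum-bounds a b s₁ s₂ {e₁} {e₂} le₁ le₂ refl refl =
    subst₂ _≤_ (regroup e₁ a e₂ b) (sym (*-distribˡ-+ 2 s₁ s₂)) (+-mono-≤ le₁ le₂)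
    where
    regroup : ∀ e₁ a e₂ b → (e₁ + a) + (e₂ + b) ≡ e₁ + e₂ + (a + b)
    regroup = solve-∀

  -- If the complement of S falls apart, both pieces can be added to S separately.
  sparse-ind : ∀ fuel S → n G ≤ fuel + size S → Ind G S → (∃[ x ] S x ≡ false) →
    Bound S (Conn (toGr G) (Out S))
  sparse-ind zero S le ind (x , Sx) = ⊥-elim (<⇒≱
    (size-< {S = S} {λ _ → true} (λ _ _ → refl) x Sx refl)
    (≤-trans (≤-reflexive (size-all {S = λ _ → true} (λ _ → refl))) le))
  sparse-ind (suc fuel) S le ind proper with conn⊎cut G (λ x → S x 𝔹.≟ false)
  ... | inj₁ con = inj₁ (con , tight S (proper , ind , con))
  ... | inj₂ (c , mono , x , y , Sx , Sy , cx , cy) = inj₂ bound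
    where
    open Split {G} (λ _ → true) S (λ _ _ → refl) c (λ e p q → mono e (proj₂ p) (proj₂ q))
    open Parts {x} {y} refl refl cx cy Sx Sy
    ∨-l : ∀ {a b} → a ∨ b ≡ true → b ≡ false → a ≡ true
    ∨-l {true} _ _ = refl
    ∨-l {false} refl ()
    -- The vertices outside `L` have colour `false` and are not in `S`, so an edge leaving `L` can
    -- only start in `S`.
    closedL : ∀ {a b} → Link G a b → L a ≡ true → L b ≡ false → S a ≡ true
    closedL {a} {b} l La Lb with true⊎false (S a)
    ... | inj₁ Sa = Sa
    ... | inj₂ Sa = ⊥-elim (true≢false
      (trans (sym (mono-link {G} {Out S} {c} mono l Sa (proj₂ (∨-false {c b} Lb)))) (∨-l La Sa))
      (proj₁ (∨-false {c b} Lb)))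
    closedR : ∀ {a b} → Link G a b → R a ≡ true → R b ≡ false → S a ≡ true
    closedR {a} {b} l Ra Rb with true⊎false (S a)
    ... | inj₁ Sa = Sa
    ... | inj₂ Sa = ⊥-elim (true≢false
      (not-false (proj₁ (∨-false {not (c b)} Rb)))
      (trans (sym (mono-link {G} {Out S} {c} mono l Sa (proj₂ (∨-false {not (c b)} Rb))))
        (not-true (∨-l Ra Sa))))
    larger : ∀ {U} → size S < size U → n G ≤ fuel + size U
    larger {U} lt = ≤-trans le
      (subst (_≤ fuel + size U) (+-suc fuel (size S)) (+-monoʳ-≤ fuel lt))
    boundL : edges G L + 3 ≤ 2 * size L
    boundL = bound⇒≤ (sparse-ind fuel L (larger {L} (size-< core⊆L x Sx Lx))
      (ind-enlarge core⊆L closedL tc ind) (y , Ly))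
    boundR : edges G R + 3 ≤ 2 * size R
    boundR = bound⇒≤ (sparse-ind fuel R (larger {R} (size-< core⊆R y Sy Ry))
      (ind-enlarge core⊆R closedR tc ind) (x , Rx))
    bound : edges G S + 4 ≤ 2 * size S
    -- The two bounds add up to |E| + |E(S)| + 6 ≤ 2|V| + 2|S|, and 2|V| = |E| + 2 leaves the
    -- constant 4.
    bound = +-cancelˡ-≤ (m G + 2) _ _ (subst₂ _≤_ (regroup (m G) (edges G S))
      (trans (*-distribˡ-+ 2 (n G) (size S)) (cong (_+ 2 * size S) (sym count)))
      (sum-bounds 3 3 (size L) (size R) boundL boundR
        (trans split-edges (cong (_+ edges G S) (edges-all (λ _ → refl))))
        (trans split-size (cong (_+ size S) (size-all {n G} (λ _ → refl))))))
      where
      regroup : ∀ m e → m + e + 6 ≡ m + 2 + (e + 4)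
      regroup = solve-∀

  edges-subsingleton : ∀ {S} x → (∀ y → S y ≡ true → y ≡ x) → edges G S ≡ 0
  edges-subsingleton {S} x only = sumF-0 none
    where
    none : ∀ e → 𝟙 (inE G S e) ≡ 0
    none e with inE G S e in eq
    ... | false = refl
    ... | true with ∧-true {S (proj₁ (endsG G e))} eq
    ... | p , q = ⊥-elim (TC.loopFree tc e (trans (only _ p) (sym (only _ q))))

  TwoIn : Subset (n G) → Set
  TwoIn S = Σ[ x ∈ Fin (n G) ] Σ[ y ∈ Fin (n G) ] (x ≢ y × S x ≡ true × S y ≡ true)

  -- A single vertex spans 0 = 2 · 1 - 2 edges, so 2 is the best constant for parts that may be
  -- singletons. For a disconnected set this suffices: the parts are disjoint and 2 + 2 = 4.
  weak-bound : ∀ {S} → (TwoIn S → edges G S + 3 ≤ 2 * size S) → ∀ x → S x ≡ true →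
    edges G S + 2 ≤ 2 * size S
  weak-bound {S} strong x Sx with any? (λ y → (x ≢? y) ×-dec (S y 𝔹.≟ true))
  ... | yes (y , x≢y , Sy) = ≤-trans (+-monoʳ-≤ (edges G S) (s≤s (s≤s z≤n))) (strong (x , y , x≢y , Sx , Sy))
  ... | no none = subst (λ e → e + 2 ≤ 2 * size S) (sym (edges-subsingleton {S} x only)) (*-monoʳ-≤ 2 (size-≥1 x Sx))
    where
    only : ∀ y → S y ≡ true → y ≡ x
    only y Sy with x F.≟ y
    ... | yes eq = sym eq
    ... | no ne = ⊥-elim (none (y , ne , Sy))

  -- A set that is not 2-connected is split at a cut vertex (or along the empty set).
  sparse : ∀ fuel S → size S < fuel → (∃[ x ] S x ≡ false) → TwoIn S →
    Bound S (Ind G S × Conn (toGr G) (Out S))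
  sparse (suc fuel) S (s≤s le) proper@(o , So) two with conn⊎cut G (λ x → S x 𝔹.≟ true)
  ... | inj₂ (c , mono , x , y , Sx , Sy , cx , cy) = inj₂ (sum-bounds 2 2 (size L) (size R)
      (weak-bound {L} (λ t → bound⇒≤ (sparse fuel L (≤-trans L<Q le) (o , outside L⊆Q) t)) x Lx)
      (weak-bound {R} (λ t → bound⇒≤ (sparse fuel R (≤-trans R<Q le) (o , outside R⊆Q) t)) y Ry)
      (trans split-edges (trans (cong (edges G S +_) (sumF-0 {m G} (λ _ → refl))) (+-identityʳ _)))
      (trans split-size (trans (cong (size S +_) (sumF-0 {n G} (λ _ → refl))) (+-identityʳ _))))
    where
    open Split {G} S (λ _ → false) (λ _ ()) c (λ e p q → mono e (proj₁ p) (proj₁ q))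
    open Parts {x} {y} Sx Sy cx cy refl refl
    outside : ∀ {U : Subset (n G)} → (∀ x → U x ≡ true → S x ≡ true) → U o ≡ false
    outside {U} sub with true⊎false (U o)
    ... | inj₁ Uo = ⊥-elim (true≢false (sub o Uo) So)
    ... | inj₂ Uo = Uo
  ... | inj₁ con with choose {A = λ v → Cut (toGr G) (InMinus S v)} {B = λ v → Conn (toGr G) (InMinus S v)}
                       (λ v → swap (conn⊎cut G (λ x → (S x 𝔹.≟ true) ×-dec (x ≢? v))))
  ... | inj₂ minus with sparse-ind (n G) S (m≤m+n (n G) (size S)) ind proper
    where
    ind : Ind G S
    ind = record { distinct = two ; whole = con ; minus = minus }
  ... | inj₁ (conO , eq) = inj₁ ((record { distinct = two ; whole = con ; minus = minus } , conO) , eq)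
  ... | inj₂ le = inj₂ le
  sparse (suc fuel) S (s≤s le) proper@(o , So) two | inj₁ con
    | inj₁ (v , c , mono , x , y , (Sx , x≢v) , (Sy , y≢v) , cx , cy) = inj₂
      -- The cut vertex is counted in both parts, so 2|L| + 2|R| = 2|S| + 2 and 6 - 2 = 4 remains.
      -- Each part has a second vertex besides `v`, which permits the constant 3.
      (+-cancelʳ-≤ 2 _ _ (subst₂ _≤_ (sym (+-assoc (edges G S) 4 2)) (regroup (size S))
        (sum-bounds 3 3 (size L) (size R)
          (bound⇒≤ (sparse fuel L (≤-trans L<Q le) (o , outside L⊆Q) (x , v , x≢v , Lx , core⊆L v (is-refl v))))
          (bound⇒≤ (sparse fuel R (≤-trans R<Q le) (o , outside R⊆Q) (y , v , y≢v , Ry , core⊆R v (is-refl v))))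
          (trans split-edges (trans (cong (edges G S +_) (edges-subsingleton {is v} v (λ y → is-true))) (+-identityʳ _)))
          (trans split-size (cong (size S +_) (trans (sumF-only v (λ j ne → cong 𝟙 (is-≢ ne))) (cong 𝟙 (is-refl v))))))))
    where
    -- If `v` were outside `S`, removing it would change nothing and the cut would contradict `con`.
    Sv : S v ≡ true
    Sv with true⊎false (S v)
    ... | inj₁ eq = eq
    ... | inj₂ eq = ⊥-elim (true≢false (trans (sym (con c
      (λ e p q → mono e (p , λ { refl → true≢false p eq }) (q , λ { refl → true≢false q eq }))
      x y Sx Sy)) cx) cy)
    open Split {G} S (is v) (λ z eq → subst (λ w → S w ≡ true) (sym (is-true eq)) Sv) c
      (λ e p q → mono e (proj₁ p , is-false (proj₂ p)) (proj₁ q , is-false (proj₂ q)))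
    open Parts {x} {y} Sx Sy cx cy (is-≢ x≢v) (is-≢ y≢v)
    outside : ∀ {U : Subset (n G)} → (∀ x → U x ≡ true → S x ≡ true) → U o ≡ false
    outside {U} sub with true⊎false (U o)
    ... | inj₁ Uo = ⊥-elim (true≢false (sub o Uo) So)
    ... | inj₂ Uo = Uo
    regroup : ∀ s → 2 * (s + 1) ≡ 2 * s + 2
    regroup = solve-∀

-- Two-vertex cuts of tight graphs.

size-pair : {u v : Fin k} → u ≢ v → size (pair u v) ≡ 2
size-pair {u = u} {v} u≢v = trans
  (sumF-two u≢v (λ x p q → cong 𝟙 (pair-out⁻ p q)))
  (cong₂ _+_ (cong 𝟙 (pair-l u v)) (cong 𝟙 (pair-r u v)))

module Separation {G : MGraph} (tc : TC G) (ti : Tight G) {u v : Fin (n G)} (u≢v : u ≢ v)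
  (c : Fin (n G) → Bool) (mono : Mono (toGr G) (Out (pair u v)) c)
  {x y : Fin (n G)} (x-out : pair u v x ≡ false) (y-out : pair u v y ≡ false)
  (cx : c x ≡ true) (cy : c y ≡ false) where

  open Sparsity tc ti

  open Split {G} (λ _ → true) (pair u v) (λ _ _ → refl) c (λ e p q → mono e (proj₂ p) (proj₂ q)) public
  open Parts {x} {y} refl refl cx cy x-out y-out public

  private
    sizes : size L + size R ≡ n G + 2
    sizes = trans split-size (cong₂ _+_ (size-all (λ _ → refl)) (size-pair u≢v))

    edge-sum : edges G L + edges G R ≡ m G + edges G (pair u v)
    edge-sum = trans split-edges (cong (_+ edges G (pair u v)) (edges-all (λ _ → refl)))

    2n+4 : 2 * (n G + 2) ≡ m G + 6
    2n+4 = trans (*-distribˡ-+ 2 (n G) 2) (trans (cong (_+ 4) (sym (Tight.count ti))) (+-assoc (m G) 2 4))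

    -- Since 2|L| + 2|R| = 2(|V| + 2) = |E| + 6, the two constants can add up to at most 6. Hence
    -- neither side is in the strict case of `Bound`.
    too-few : ∀ a b → edges G L + a ≤ 2 * size L → edges G R + b ≤ 2 * size R → a + b ≡ 7 → ⊥
    too-few a b p q a+b = <⇒≱ {m G + 6} {m G + edges G (pair u v) + 7}
      (+-mono-≤-< (m≤m+n (m G) _) ≤-refl)
      (subst₂ _≤_ (cong (m G + edges G (pair u v) +_) a+b) 2n+4 (sum-bounds a b (size L) (size R) p q edge-sum sizes))

    boundL : Bound L (Ind G L × Conn (toGr G) (Out L))
    boundL = sparse (suc (size L)) L ≤-refl (y , Ly) (u , v , u≢v , core⊆L u (pair-l u v) , core⊆L v (pair-r u v))

    boundR : Bound R (Ind G R × Conn (toGr G) (Out R))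
    boundR = sparse (suc (size R)) R ≤-refl (x , Rx) (u , v , u≢v , core⊆R u (pair-l u v) , core⊆R v (pair-r u v))

  tightL : (Ind G L × Conn (toGr G) (Out L)) × edges G L + 3 ≡ 2 * size L
  tightL with boundL
  ... | inj₁ t = t
  ... | inj₂ le = ⊥-elim (too-few 4 3 le (bound⇒≤ boundR) refl)

  tightR : (Ind G R × Conn (toGr G) (Out R)) × edges G R + 3 ≡ 2 * size R
  tightR with boundR
  ... | inj₁ t = t
  ... | inj₂ le = ⊥-elim (too-few 3 4 (bound⇒≤ boundL) le refl)

  -- Edges between `u` and `v` are counted on both sides, and 3 + 3 already exhausts the available
  -- 6.
  non-adjacent : edges G (pair u v) ≡ 0
  non-adjacent = n≤0⇒n≡0 (+-cancelˡ-≤ (m G) _ _ (+-cancelʳ-≤ 6 _ _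
    (subst (m G + edges G (pair u v) + 6 ≤_) (trans 2n+4 (cong (_+ 6) (sym (+-identityʳ (m G)))))
      (sum-bounds 3 3 (size L) (size R) (≤-reflexive (proj₂ tightL)) (≤-reflexive (proj₂ tightR)) edge-sum sizes))))

-- Two vertices, and the complete graph on four vertices

good-size : ∀ {G S} → Good G S → 2 ≤ size S × size S < n G
good-size {G} {S} ((x , Sx) , ind , _) = ind-size ind
  , subst (size S <_) (size-all {S = λ _ → true} (λ _ → refl))
      (size-< {S = S} {λ _ → true} (λ _ _ → refl) x Sx refl)

C₂⇒tight : ∀ {G} → IsC2 G → Tight G
C₂⇒tight {G} (n≡2 , m≡2 , _) = record
  { count = trans (cong (_+ 2) m≡2) (cong (2 *_) (sym n≡2))
  ; tight = λ S good → let lo , hi = good-size {G} {S} good in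
      ⊥-elim (<⇒≱ (subst (size S <_) n≡2 hi) lo) }

tight⇒C₂ : ∀ {G} → TC G → Tight G → n G ≡ 2 → IsC2 G
tight⇒C₂ {G} tc ti n≡2 = n≡2
  , +-cancelʳ-≡ 2 _ _ (trans (Tight.count ti) (cong (2 *_) n≡2)) , TC.loopFree tc

uEq? : (a b : Fin k × Fin k) → Dec (UEq a b)
uEq? (a , b) (c , d) = ((a F.≟ c) ×-dec (b F.≟ d)) ⊎-dec ((a F.≟ d) ×-dec (b F.≟ c))

uEq-sym : {A : Set} {a b : A × A} → UEq a b → UEq b a
uEq-sym (inj₁ (refl , refl)) = inj₁ (refl , refl)
uEq-sym (inj₂ (refl , refl)) = inj₂ (refl , refl)

uEq-trans : {A : Set} {a b c : A × A} → UEq a b → UEq b c → UEq a c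
uEq-trans (inj₁ (refl , refl)) q = q
uEq-trans (inj₂ (refl , refl)) (inj₁ (refl , refl)) = inj₂ (refl , refl)
uEq-trans (inj₂ (refl , refl)) (inj₂ (refl , refl)) = inj₁ (refl , refl)

uEq-both : {A : Set} {a b : A × A} (S : A → Bool) → UEq a b →
  S (proj₁ a) ∧ S (proj₂ a) ≡ S (proj₁ b) ∧ S (proj₂ b)
uEq-both S (inj₁ (refl , refl)) = refl
uEq-both {b = b} S (inj₂ (refl , refl)) = ∧-comm (S (proj₂ b)) (S (proj₁ b))

pairs : Fin 6 → Fin 4 × Fin 4
pairs zero                                = # 0 , # 1
pairs (suc zero)                          = # 0 , # 2
pairs (suc (suc zero))                    = # 0 , # 3
pairs (suc (suc (suc zero)))              = # 1 , # 2
pairs (suc (suc (suc (suc zero))))        = # 1 , # 3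
pairs (suc (suc (suc (suc (suc zero)))))  = # 2 , # 3

pairs-distinct : ∀ j → proj₁ (pairs j) ≢ proj₂ (pairs j)
pairs-distinct = from-yes (all? λ j → proj₁ (pairs j) ≢? proj₂ (pairs j))

pairs-surjective : ∀ s t → s ≢ t → ∃[ j ] UEq (pairs j) (s , t)
pairs-surjective = from-yes (all? λ s → all? λ t → (s ≢? t) →-dec any? λ j → uEq? (pairs j) (s , t))

pairs-injective : ∀ i j → UEq (pairs i) (pairs j) → i ≡ j
pairs-injective = from-yes (all? λ i → all? λ j → uEq? (pairs i) (pairs j) →-dec (i F.≟ j))

-- A set of s vertices spans s(s - 1)/2 edges, and s(s - 1)/2 + 3 = 2s amounts to (s - 2)(s - 3) =
-- 0.
pairs-count : (S : Subset 4) → 2 ≤ size S → size S < 4 →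
  sumF (λ j → 𝟙 (S (proj₁ (pairs j)) ∧ S (proj₂ (pairs j)))) + 3 ≡ 2 * size S
pairs-count S lo hi with S (# 0) | S (# 1) | S (# 2) | S (# 3)
pairs-count S lo (s≤s (s≤s (s≤s (s≤s ())))) | true | true | true | true
... | true  | true  | true  | false = refl
... | true  | true  | false | true  = refl
... | true  | true  | false | false = refl
... | true  | false | true  | true  = refl
... | true  | false | true  | false = refl
... | true  | false | false | true  = refl
pairs-count S (s≤s ()) hi | true | false | false | false
... | false | true  | true  | true  = refl
... | false | true  | true  | false = refl
... | false | true  | false | true  = refl
pairs-count S (s≤s ()) hi | false | true | false | false
... | false | false | true  | true  = refl
pairs-count S (s≤s ()) hi | false | false | true  | false
pairs-count S (s≤s ()) hi | false | false | false | true
pairs-count S () hi | false | false | false | false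

K₄⇒tight : ∀ {G} → IsK4 G → Tight G
K₄⇒tight {G@record { n = .4 ; m = m }} (refl , lf , unique) = record
  { count = cong (_+ 2) (trans (sym (sumF-1 m)) (reindex (λ _ → 1)))
  ; tight = λ S good → let lo , hi = good-size {G} {S} good in
      trans (cong (_+ 3) (trans (reindex (𝟙 ∘ inE G S))
        (sumF-cong (λ j → cong 𝟙 (uEq-both S (edge-ends j)))))) (pairs-count S lo hi) }
  where
  edge : Fin 6 → Fin m
  edge j = proj₁ (unique _ _ (pairs-distinct j))
  edge-ends : ∀ j → UEq (endsG G (edge j)) (pairs j)
  edge-ends j = proj₁ (proj₂ (unique _ _ (pairs-distinct j)))
  -- `IsK4` fixes neither the number nor the order of the edges; constant `g = 1` shows that there
  -- are six.
  reindex : (g : Fin m → ℕ) → sumF g ≡ sumF (g ∘ edge)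
  reindex g = sumF-match g (g ∘ edge) M rows cols
    where
    M : Fin m → Fin 6 → ℕ
    M f j = if is (edge j) f then g f else 0
    cols : ∀ j → sumF (λ f → M f j) ≡ g (edge j)
    cols j = trans (sumF-only (edge j) (λ f ne → cong (if_then g f else 0) (is-≢ ne)))
      (cong (if_then g (edge j) else 0) (is-refl (edge j)))
    rows : ∀ f → sumF (M f) ≡ g f
    rows f with pairs-surjective _ _ (lf f)
    ... | j , ue = trans (sumF-only j off) (cong (if_then g f else 0) (dec-true (f F.≟ edge j) f≡))
      where
      f≡ : f ≡ edge j
      f≡ = proj₂ (proj₂ (unique _ _ (pairs-distinct j))) f (uEq-sym ue)
      off : ∀ i → i ≢ j → M f i ≡ 0
      off i i≢j = cong (if_then g f else 0) (is-≢ {i = edge i} {f} (λ { refl → i≢j (pairs-injective i j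
        (uEq-trans (uEq-sym (edge-ends i)) (uEq-sym ue))) }))

-- Tight graphs without a two-vertex cut.

twoOthers : 3 ≤ k → (v : Fin k) → Σ[ x ∈ Fin k ] Σ[ y ∈ Fin k ] (x ≢ y × x ≢ v × y ≢ v)
twoOthers (s≤s (s≤s (s≤s _))) zero          = suc zero , suc (suc zero) , (λ ()) , (λ ()) , (λ ())
twoOthers (s≤s (s≤s (s≤s _))) (suc zero)    = zero , suc (suc zero) , (λ ()) , (λ ()) , (λ ())
twoOthers (s≤s (s≤s (s≤s _))) (suc (suc v)) = zero , suc zero , (λ ()) , (λ ()) , (λ ())

-- On four vertices the complement of a pair is a pair, so if no pair is a vertex cut, then every
-- pair is itself connected.
complementary : (u v : Fin 4) → u ≢ v → ∃[ w ] ∃[ z ]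
  (w ≢ z × (∀ x → (pair w z x ≡ false → pair u v x ≡ true) × (pair u v x ≡ true → pair w z x ≡ false)))
complementary = from-yes (all? {4} λ u → all? λ v → (u ≢? v) →-dec any? λ w → any? λ z →
  (w ≢? z) ×-dec all? λ x → ((pair w z x 𝔹.≟ false) →-dec (pair u v x 𝔹.≟ true))
    ×-dec ((pair u v x 𝔹.≟ true) →-dec (pair w z x 𝔹.≟ false)))

complementary′ : k ≡ 4 → (u v : Fin k) → u ≢ v → ∃[ w ] ∃[ z ]
  (w ≢ z × (∀ x → (pair w z x ≡ false → pair u v x ≡ true) × (pair u v x ≡ true → pair w z x ≡ false)))
complementary′ refl = complementary

ind-pair : ∀ {G u v} → u ≢ v → Link G u v → Ind G (pair u v)
ind-pair {G} {u} {v} u≢v link = record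
  { distinct = u , v , u≢v , pair-l u v , pair-r u v
  ; whole = con id
  ; minus = λ w → con proj₁ }
  where
  con : {P : Fin (n G) → Set} → (∀ {x} → P x → pair u v x ≡ true) → Conn (toGr G) P
  con {P} sub c mono x y px py with pair-cases u v x (sub px) | pair-cases u v y (sub py)
  ... | inj₁ refl | inj₁ refl = refl
  ... | inj₂ refl | inj₂ refl = refl
  ... | inj₁ refl | inj₂ refl = mono-link {G} {P} {c} mono link px py
  ... | inj₂ refl | inj₁ refl = mono-link {G} {P} {c} mono (link-sym {G} link) px py

module ThreeConnected {G : MGraph} (tc : TC G) (ti : Tight G) (3≤n : 3 ≤ n G)
  (conn : ∀ u v → u ≢ v → Conn (toGr G) (Out (pair u v))) where

  open TC tc
  open Tight ti

  rest : Fin (n G) → Subset (n G)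
  rest v x = not (is v x)

  rest-≢ : ∀ {v x} → x ≢ v → rest v x ≡ true
  rest-≢ ne = cong not (is-≢ ne)

  ≢-rest : ∀ v x → rest v x ≡ true → x ≢ v
  ≢-rest v x eq = is-false {i = v} {x} (not-true eq)

  -- A cut vertex `w` of `G` minus `v` would make `{v , w}` a 2-vertex cut, and the complement of
  -- `rest v` is a single vertex.
  rest-good : ∀ v → Good G (rest v)
  rest-good v = (v , cong not (is-refl v)) , ind , alone
    where
    conn-rest : Conn (toGr G) (In (rest v))
    conn-rest = conn-resp {P = _≢ v} rest-≢ (λ {x} → ≢-rest v x) (minus v)
    ind : Ind G (rest v)
    ind = record
      { distinct = let x , y , x≢y , x≢v , y≢v = twoOthers 3≤n v in x , y , x≢y , rest-≢ x≢v , rest-≢ y≢v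
      ; whole = conn-rest
      ; minus = conn-minus }
      where
      conn-minus : ∀ w → Conn (toGr G) (InMinus (rest v) w)
      conn-minus w with w F.≟ v
      ... | yes refl = conn-resp {P = In (rest v)} (λ {x} p → p , ≢-rest v x p) proj₁ conn-rest
      ... | no w≢v = conn-resp {P = Out (pair v w)}
        (λ {x} p → let a , b = pair-out v w x p in rest-≢ a , b)
        (λ {x} (p , q) → pair-out⁻ (≢-rest v x p) q) (conn v w (w≢v ∘ sym))
    alone : Conn (toGr G) (Out (rest v))
    alone c mono x y p q with is-true {i = v} {x} (not-false p) | is-true {i = v} {y} (not-false q)
    ... | refl | refl = refl

  degree : Fin (n G) → ℕ
  degree v = sumF (λ e → 𝟙 (is v (proj₁ (endsG G e))) + 𝟙 (is v (proj₂ (endsG G e))))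

  edges-degree : ∀ v → edges G (rest v) + degree v ≡ m G
  edges-degree v = trans (sym (sumF-+ (𝟙 ∘ inE G (rest v)) _)) (trans (sumF-cong pointwise) (sumF-1 (m G)))
    where
    pointwise : ∀ e → 𝟙 (inE G (rest v) e)
      + (𝟙 (is v (proj₁ (endsG G e))) + 𝟙 (is v (proj₂ (endsG G e)))) ≡ 1
    pointwise e with proj₁ (endsG G e) F.≟ v | proj₂ (endsG G e) F.≟ v
    ... | yes p | yes q = ⊥-elim (loopFree e (trans p (sym q)))
    ... | yes _ | no _  = refl
    ... | no _  | yes _ = refl
    ... | no _  | no _  = refl

  size-rest : ∀ v → size (rest v) + 1 ≡ n G
  size-rest v = trans (cong (size (rest v) +_) (sym one))
    (trans (sym (sumF-+ (𝟙 ∘ rest v) (𝟙 ∘ is v))) (trans (sumF-cong pointwise) (sumF-1 (n G))))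
    where
    one : size (is v) ≡ 1
    one = trans (sumF-only v (λ j ne → cong 𝟙 (is-≢ ne))) (cong 𝟙 (is-refl v))
    pointwise : ∀ x → 𝟙 (rest v x) + 𝟙 (is v x) ≡ 1
    pointwise x with is v x
    ... | true = refl
    ... | false = refl

  -- |E| = 2|V| - 2, and 2(|V| - 1) - 3 edges avoid `v`; the difference is 3.
  degree≡3 : ∀ v → degree v ≡ 3
  degree≡3 v = +-cancelˡ-≡ (edges G (rest v)) _ _ (trans (edges-degree v)
    (+-cancelʳ-≡ 2 _ _ (trans count (trans (cong (2 *_) (sym (size-rest v)))
      (trans (*-distribˡ-+ 2 (size (rest v)) 1) (cong (_+ 2) (sym (tight (rest v) (rest-good v)))))))))

  handshake : sumF degree ≡ m G * 2
  handshake = trans (sumF-swap (λ v e → 𝟙 (is v (proj₁ (endsG G e))) + 𝟙 (is v (proj₂ (endsG G e)))))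
    (trans (sumF-cong (λ e → trans (sumF-+ (λ v → 𝟙 (is v (proj₁ (endsG G e)))) _)
      (cong₂ _+_ (one (proj₁ (endsG G e))) (one (proj₂ (endsG G e)))))) (sumF-const (m G) 2))
    where
    one : ∀ x → sumF (λ v → 𝟙 (is v x)) ≡ 1
    one x = trans (sumF-only x (λ v ne → cong 𝟙 (is-≢ (ne ∘ sym)))) (cong 𝟙 (is-refl x))

  -- The handshake identity gives 3|V| = 2|E| = 4|V| - 4.
  n≡4 : n G ≡ 4
  n≡4 = sym (+-cancelˡ-≡ (n G * 3) 4 (n G) (trans (cong (_+ 4) 3n≡2m)
    (trans (double (m G)) (trans (cong (2 *_) count) (quad (n G))))))
    where
    3n≡2m : n G * 3 ≡ m G * 2
    3n≡2m = trans (sym (trans (sumF-cong degree≡3) (sumF-const (n G) 3))) handshake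
    double : ∀ m → m * 2 + 4 ≡ 2 * (m + 2)
    double = solve-∀
    quad : ∀ n → 2 * (2 * n) ≡ n * 3 + n
    quad = solve-∀

  isK₄ : IsK4 G
  isK₄ = n≡4 , loopFree , unique
    where
    unique : ∀ u v → u ≢ v → Σ[ e ∈ Fin (m G) ] (UEq (endsG G e) (u , v) ×
      (∀ f → UEq (endsG G f) (u , v) → f ≡ e))
    unique u v u≢v with any? (λ e → uEq? (endsG G e) (u , v)) | complementary′ n≡4 u v u≢v
    -- Without an edge between `u` and `v` the colouring `is u` would separate them in the
    -- complement of `{w , z}`, which is `{u , v}`.
    ... | no none | w , z , w≢z , compl = ⊥-elim (true≢false
        (trans (sym (conn w z w≢z (is u) mono u v (proj₂ (compl u) (pair-l u v))
          (proj₂ (compl v) (pair-r u v)))) (is-refl u)) (is-≢ (u≢v ∘ sym)))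
      where
      mono : Mono (toGr G) (Out (pair w z)) (is u)
      mono e p q with pair-cases u v (proj₁ (endsG G e)) (proj₁ (compl (proj₁ (endsG G e))) p)
                    | pair-cases u v (proj₂ (endsG G e)) (proj₁ (compl (proj₂ (endsG G e))) q)
      ... | inj₁ a | inj₁ b = ⊥-elim (loopFree e (trans a (sym b)))
      ... | inj₂ a | inj₂ b = ⊥-elim (loopFree e (trans a (sym b)))
      ... | inj₁ a | inj₂ b = ⊥-elim (none (e , inj₁ (a , b)))
      ... | inj₂ a | inj₁ b = ⊥-elim (none (e , inj₂ (a , b)))
    ... | yes (e , ue) | w , z , _ , compl = e , ue , only
      where
      -- An adjacent pair is a good flat, and its equation 2 · 2 - 3 = 1 excludes parallel edges.
      one-edge : edges G (pair u v) ≡ 1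
      one-edge = +-cancelʳ-≡ 3 _ _ (trans (tight (pair u v)
        ((w , out) , ind-pair {G} u≢v (e , ue) , conn u v u≢v)) (cong (2 *_) (size-pair u≢v)))
        where
        out : pair u v w ≡ false
        out with true⊎false (pair u v w)
        ... | inj₂ eq = eq
        ... | inj₁ eq = ⊥-elim (true≢false (pair-l w z) (proj₂ (compl w) eq))
      within : ∀ f → UEq (endsG G f) (u , v) → inE G (pair u v) f ≡ true
      within f uf = trans (uEq-both (pair u v) uf) (cong₂ _∧_ (pair-l u v) (pair-r u v))
      only : ∀ f → UEq (endsG G f) (u , v) → f ≡ e
      only f uf with f F.≟ e
      ... | yes eq = eq
      ... | no ne = ⊥-elim (<⇒≱ ≤-refl (subst (2 ≤_) one-edge (size-≥2 f e ne (within f uf) (within e ue))))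

-- Gluing two graphs along an edge

record Glue (G₁ G₂ H : MGraph) : Set where
  field
    e₁  : Fin (m G₁)
    e₂  : Fin (m G₂)
    φ₁  : Fin (n G₁) → Fin (n H)
    φ₂  : Fin (n G₂) → Fin (n H)
    φ₁-inj : ∀ x y → φ₁ x ≡ φ₁ y → x ≡ y
    φ₂-inj : ∀ x y → φ₂ x ≡ φ₂ y → x ≡ y
    cover  : ∀ z → (∃[ x ] φ₁ x ≡ z) ⊎ (∃[ y ] φ₂ y ≡ z)
    glue   : UEq (mapPair φ₁ (endsG G₁ e₁)) (mapPair φ₂ (endsG G₂ e₂))
    only-glue : ∀ x y → φ₁ x ≡ φ₂ y → (x ≡ proj₁ (endsG G₁ e₁)) ⊎ (x ≡ proj₂ (endsG G₁ e₁))
    ψ : ((Σ[ f ∈ Fin (m G₁) ] T (not (does (f F.≟ e₁)))) ⊎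
         (Σ[ f ∈ Fin (m G₂) ] T (not (does (f F.≟ e₂))))) ↔ Fin (m H)
    ψ-ends₁ : ∀ f → UEq (endsG H (Inverse.to ψ (inj₁ f))) (mapPair φ₁ (endsG G₁ (proj₁ f)))
    ψ-ends₂ : ∀ f → UEq (endsG H (Inverse.to ψ (inj₂ f))) (mapPair φ₂ (endsG G₂ (proj₁ f)))

constrA⇒glue : ∀ {δ G₁ G₂ H} → ConstrA δ G₁ G₂ H → Glue G₁ G₂ H
constrA⇒glue C = record
  { e₁ = e₁ ; e₂ = e₂ ; φ₁ = φ₁ ; φ₂ = φ₂ ; φ₁-inj = φ₁-inj ; φ₂-inj = φ₂-inj
  ; cover = cover ; glue = glue ; only-glue = only-glue
  ; ψ = ψ ; ψ-ends₁ = ψ-ends₁ ; ψ-ends₂ = ψ-ends₂ }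
  where open ConstrA C

⊎-swap-↔ : {A B C : Set} → (A ⊎ B) ↔ C → (B ⊎ A) ↔ C
⊎-swap-↔ ψ = mk↔ₛ′ (Inverse.to ψ ∘ swap) (swap ∘ Inverse.from ψ)
  (λ z → trans (cong (Inverse.to ψ) (swap-involutive _)) (Inverse.strictlyInverseˡ ψ z))
  (λ z → trans (cong swap (Inverse.strictlyInverseʳ ψ _)) (swap-involutive _))

uEq-r : {A : Set} {a b : A × A} → UEq a b → ∀ {z} → z ≡ proj₁ a ⊎ z ≡ proj₂ a → z ≡ proj₁ b ⊎ z ≡ proj₂ b
uEq-r (inj₁ (refl , refl)) z = z
uEq-r (inj₂ (refl , refl)) z = swap z

-- The weights in `ConstrA` tell the two sides apart; `Glue` keeps only the symmetric data, so that
-- each lemma about the left side also serves for the right one.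
glue-swap : ∀ {G₁ G₂ H} → Glue G₁ G₂ H → Glue G₂ G₁ H
glue-swap {G₁} {G₂} g = record
  { e₁ = e₂ ; e₂ = e₁ ; φ₁ = φ₂ ; φ₂ = φ₁ ; φ₁-inj = φ₂-inj ; φ₂-inj = φ₁-inj
  ; cover = swap ∘ cover ; glue = uEq-sym glue ; only-glue = only
  ; ψ = ⊎-swap-↔ ψ ; ψ-ends₁ = ψ-ends₂ ; ψ-ends₂ = ψ-ends₁ }
  where
  open Glue g
  only : ∀ y x → φ₂ y ≡ φ₁ x → (y ≡ proj₁ (endsG G₂ e₂)) ⊎ (y ≡ proj₂ (endsG G₂ e₂))
  only y x eq = ⊎-map (φ₂-inj _ _) (φ₂-inj _ _)
    (uEq-r glue (⊎-map (trans eq ∘ cong φ₁) (trans eq ∘ cong φ₁) (only-glue x y (sym eq))))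

-- Sums over the glued graph.

left : {A B : Set} → A ⊎ B → ℕ → ℕ
left (inj₁ _) n = n
left (inj₂ _) n = 0

left+swap : {A B : Set} (z : A ⊎ B) (n : ℕ) → left z n + left (swap z) n ≡ n
left+swap (inj₁ _) n = +-identityʳ n
left+swap (inj₂ _) n = refl

-- The edges that come from one side, with the deleted edge `e` put back. The matrix `M` is the
-- graph of `ψ` restricted to that side.
sum-left : {X : Set} (e : Fin k) (ψ : ((Σ[ f ∈ Fin k ] T (not (does (f F.≟ e)))) ⊎ X) ↔ Fin l)
  (g : Fin l → ℕ) (g₁ : Fin k → ℕ) → (∀ f → g (Inverse.to ψ (inj₁ f)) ≡ g₁ (proj₁ f)) →
  sumF (λ h → left (Inverse.from ψ h) (g h)) + g₁ e ≡ sumF g₁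
sum-left {k} {l} {X} e ψ g g₁ agree = trans
  (cong₂ _+_ (sym (sumF-match kept _ M rows cols)) (sym at-e))
  (trans (sym (sumF-+ kept removed)) (sumF-cong split))
  where
  open Inverse ψ using (to; from; strictlyInverseˡ; strictlyInverseʳ)
  kept removed : Fin k → ℕ
  kept f = if is e f then 0 else g₁ f
  removed f = if is e f then g₁ f else 0
  split : ∀ f → kept f + removed f ≡ g₁ f
  split f with is e f
  ... | true = refl
  ... | false = +-identityʳ _
  at-e : sumF removed ≡ g₁ e
  at-e = trans (sumF-only e (λ f ne → cong (if_then g₁ f else 0) (is-≢ ne)))
    (cong (if_then g₁ e else 0) (is-refl e))
  hit : (Σ[ f ∈ Fin k ] T (not (does (f F.≟ e)))) ⊎ X → Fin k → ℕ → ℕ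
  hit (inj₁ (f₀ , _)) f n = if is f₀ f then n else 0
  hit (inj₂ _) f n = 0
  M : Fin k → Fin l → ℕ
  M f h = hit (from h) f (g h)
  cols : ∀ h → sumF (λ f → M f h) ≡ left (from h) (g h)
  cols h with from h
  ... | inj₁ (f₀ , _) = trans (sumF-only f₀ (λ f ne → cong (if_then g h else 0) (is-≢ ne)))
    (cong (if_then g h else 0) (is-refl f₀))
  ... | inj₂ _ = sumF-0 {k} (λ _ → refl)
  rows : ∀ f → sumF (M f) ≡ kept f
  rows f with f F.≟ e in dec
  ... | yes refl = sumF-0 none
    where
    none : ∀ h → M f h ≡ 0
    none h with from h
    ... | inj₂ _ = refl
    ... | inj₁ (f₀ , p) = cong (if_then g h else 0) (is-≢ {i = f₀} {f}
      λ { refl → true≢false (T⇒≡ p) (cong not (is-refl f)) })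
  ... | no f≢e = trans (sumF-only h₀ off) value
    where
    p : T (not (does (f F.≟ e)))
    p = ≡⇒T (cong not (is-≢ f≢e))
    h₀ : Fin l
    h₀ = to (inj₁ (f , p))
    value : M f h₀ ≡ g₁ f
    value rewrite strictlyInverseʳ (inj₁ (f , p)) | is-refl f = agree (f , p)
    off : ∀ h → h ≢ h₀ → M f h ≡ 0
    off h ne with from h in eq
    ... | inj₂ _ = refl
    ... | inj₁ (f₀ , q) = cong (if_then g h else 0) (is-≢ {i = f₀} {f}
      λ { refl → ne (trans (sym (strictlyInverseˡ h)) (cong to (trans eq
        (cong (λ r → inj₁ (f , r)) (T-irrelevant q p))))) })

image? : (φ : Fin k → Fin l) → ∀ z → Dec (∃[ x ] φ x ≡ z)
image? φ z = any? (λ x → φ x F.≟ z)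

sum-image : (φ : Fin k → Fin l) → (∀ x y → φ x ≡ φ y → x ≡ y) → (g : Fin l → ℕ) →
  sumF (g ∘ φ) ≡ sumF (λ z → if does (image? φ z) then g z else 0)
sum-image {k} {l} φ inj g = sumF-match (g ∘ φ) _ M rows cols
  where
  M : Fin k → Fin l → ℕ
  M x z = if is (φ x) z then g z else 0
  rows : ∀ x → sumF (M x) ≡ g (φ x)
  rows x = trans (sumF-only (φ x) (λ z ne → cong (if_then g z else 0) (is-≢ ne)))
    (cong (if_then g (φ x) else 0) (is-refl (φ x)))
  cols : ∀ z → sumF (λ x → M x z) ≡ (if does (image? φ z) then g z else 0)
  cols z with image? φ z
  ... | yes (x , refl) = trans (sumF-only x (λ y ne → cong (if_then g z else 0)
      (is-≢ (λ eq → ne (inj _ _ (sym eq))))))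
    (cong (if_then g z else 0) (is-refl z))
  ... | no none = sumF-0 (λ x → cong (if_then g z else 0) (is-≢ (λ eq → none (x , sym eq))))

edges-cong : ∀ G {S S′ : Subset (n G)} → (∀ x → S x ≡ S′ x) → edges G S ≡ edges G S′
edges-cong G eq = size-cong {m G} (λ e → cong₂ _∧_ (eq (proj₁ (endsG G e))) (eq (proj₂ (endsG G e))))

-- Connectivity and counting in the glued graph and its left side.

module Glued {G₁ G₂ H : MGraph} (g : Glue G₁ G₂ H) (lf₁ : LoopFree G₁) (lf₂ : LoopFree G₂) where

  open Glue g public

  u₁ v₁ : Fin (n G₁)
  u₁ = proj₁ (endsG G₁ e₁)
  v₁ = proj₂ (endsG G₁ e₁)

  u₂ v₂ : Fin (n G₂)
  u₂ = proj₁ (endsG G₂ e₂)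
  v₂ = proj₂ (endsG G₂ e₂)

  u v : Fin (n H)
  u = φ₁ u₁
  v = φ₁ v₁

  u≢v : u ≢ v
  u≢v eq = lf₁ e₁ (φ₁-inj _ _ eq)

  u-right : ∃[ y ] φ₂ y ≡ u
  u-right with glue
  ... | inj₁ (p , _) = u₂ , sym p
  ... | inj₂ (p , _) = v₂ , sym p

  v-right : ∃[ y ] φ₂ y ≡ v
  v-right with glue
  ... | inj₁ (_ , p) = v₂ , sym p
  ... | inj₂ (_ , p) = u₂ , sym p

  shared : ∀ {x y} → φ₁ x ≡ φ₂ y → φ₂ y ≡ u ⊎ φ₂ y ≡ v
  shared {x} {y} eq = ⊎-map (trans (sym eq) ∘ cong φ₁) (trans (sym eq) ∘ cong φ₁) (only-glue x y eq)

  φ₂-end : ∀ {y} → φ₂ y ≡ u ⊎ φ₂ y ≡ v → y ≡ u₂ ⊎ y ≡ v₂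
  φ₂-end z = ⊎-map (φ₂-inj _ _) (φ₂-inj _ _) (uEq-r glue z)

  φ₂-u₂-v₂ : ∀ {S : Fin (n H) → Bool} → UEq (S (φ₂ u₂) , S (φ₂ v₂)) (S u , S v)
  φ₂-u₂-v₂ {S} with glue
  ... | inj₁ (p , q) = inj₁ (cong S (sym p) , cong S (sym q))
  ... | inj₂ (p , q) = inj₂ (cong S (sym q) , cong S (sym p))

  link-left : ∀ {x y} → Link G₁ x y → UEq (u₁ , v₁) (x , y) ⊎ Link H (φ₁ x) (φ₁ y)
  link-left (e , ue) with e F.≟ e₁
  ... | yes refl = inj₁ ue
  ... | no ne = inj₂ (Inverse.to ψ (inj₁ f) , uEq-trans (ψ-ends₁ f) (push ue))
    where
    f : Σ[ f ∈ Fin (m G₁) ] T (not (does (f F.≟ e₁)))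
    f = e , ≡⇒T (cong not (is-≢ ne))
    push : ∀ {a b} → UEq a b → UEq (mapPair φ₁ a) (mapPair φ₁ b)
    push (inj₁ (refl , refl)) = inj₁ (refl , refl)
    push (inj₂ (refl , refl)) = inj₂ (refl , refl)

  -- An edge on the right is recorded by the position of its ends alone: the colourings tested
  -- against `Side` are constant on the right wherever `P` holds.
  data Side (a b : Fin (n H)) : Set where
    on-left  : ∀ x y → Link G₁ x y → φ₁ x ≡ a → φ₁ y ≡ b → Side a b
    on-right : ∀ x y → φ₂ x ≡ a → φ₂ y ≡ b → Side a b

  side : ∀ h → Side (proj₁ (endsG H h)) (proj₂ (endsG H h))
  side h with Inverse.from ψ h in eq
  ... | inj₁ f with subst (λ h → UEq (endsG H h) (mapPair φ₁ (endsG G₁ (proj₁ f)))) to-f (ψ-ends₁ f)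
    where
    to-f : Inverse.to ψ (inj₁ f) ≡ h
    to-f = trans (cong (Inverse.to ψ) (sym eq)) (Inverse.strictlyInverseˡ ψ h)
  ... | inj₁ (p , q) = on-left _ _ (edge-link G₁ (proj₁ f)) (sym p) (sym q)
  ... | inj₂ (p , q) = on-left _ _ (link-sym {G₁} (edge-link G₁ (proj₁ f))) (sym p) (sym q)
  side h | inj₂ f with subst (λ h → UEq (endsG H h) (mapPair φ₂ (endsG G₂ (proj₁ f)))) to-f (ψ-ends₂ f)
    where
    to-f : Inverse.to ψ (inj₂ f) ≡ h
    to-f = trans (cong (Inverse.to ψ) (sym eq)) (Inverse.strictlyInverseˡ ψ h)
  ... | inj₁ (p , q) = on-right _ _ (sym p) (sym q)
  ... | inj₂ (p , q) = on-right _ _ (sym p) (sym q)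

  -- Used for colourings, with `b` the colour of the far side, and for vertex sets, with `b`
  -- deciding whether the far side is added.
  extend : (Fin (n G₁) → Bool) → Bool → Fin (n H) → Bool
  extend d b z with image? φ₁ z
  ... | yes (x , _) = d x
  ... | no _ = b

  extend-φ₁ : ∀ d b x → extend d b (φ₁ x) ≡ d x
  extend-φ₁ d b x with image? φ₁ (φ₁ x)
  ... | yes (y , eq) = cong d (φ₁-inj _ _ eq)
  ... | no none = ⊥-elim (none (x , refl))

  extend-φ₂ : ∀ d b y → (φ₂ y ≡ u → d u₁ ≡ b) → (φ₂ y ≡ v → d v₁ ≡ b) → extend d b (φ₂ y) ≡ b
  extend-φ₂ d b y at-u at-v with image? φ₁ (φ₂ y)
  ... | no _ = refl
  ... | yes (x , eq) with only-glue x y eq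
  ... | inj₁ refl = at-u (sym eq)
  ... | inj₂ refl = at-v (sym eq)

  -- G₁ arises from H by contracting the other side to the edge e₁.
  conn-left : {P : Fin (n H) → Set} → (∀ z → Dec (P z)) → Conn (toGr H) P → Conn (toGr G₁) (P ∘ φ₁)
  conn-left {P} P? con d mono x y px py =
    trans (sym (extend-φ₁ d κ x)) (trans (con (extend d κ) mono′ (φ₁ x) (φ₁ y) px py) (extend-φ₁ d κ y))
    where
    -- The far side takes the colour of an end of `e₁` that lies in `P`; if both do, the edge `e₁`
    -- makes their colours equal.
    κ : Bool
    κ = if does (P? u) then d u₁ else d v₁
    at-u : P u → d u₁ ≡ κ
    at-u pu rewrite dec-true (P? u) pu = refl
    at-v : P v → d v₁ ≡ κ
    at-v pv with P? u
    ... | yes pu = sym (mono e₁ pu pv)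
    ... | no _ = refl
    right : ∀ y → P (φ₂ y) → extend d κ (φ₂ y) ≡ κ
    right y py = extend-φ₂ d κ y (λ eq → at-u (subst P eq py)) (λ eq → at-v (subst P eq py))
    mono′ : Mono (toGr H) P (extend d κ)
    mono′ h p q with proj₁ (endsG H h) | proj₂ (endsG H h) | side h
    ... | _ | _ | on-left x y l refl refl = trans (extend-φ₁ d κ x)
      (trans (mono-link {G₁} {P ∘ φ₁} {d} mono l p q) (sym (extend-φ₁ d κ y)))
    ... | _ | _ | on-right x y refl refl = trans (right x p) (sym (right y q))

  Right : Fin (n H) → Set
  Right z = ∃[ y ] φ₂ y ≡ z

  -- The edge `e₁`, which `H` lacks, is replaced by a connection through the right side. The last
  -- hypothesis joins the two sides: they share a vertex of `P`, or `P` has none on the right.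
  conn-glue : {P : Fin (n H) → Set} → Conn (toGr G₁) (P ∘ φ₁) →
    Conn (toGr H) (λ z → Right z × P z) → (P u ⊎ P v) ⊎ (∀ y → ¬ P (φ₂ y)) → Conn (toGr H) P
  conn-glue {P} con₁ con₂ anchor c mono x y px py = compare x y px py (cover x) (cover y)
    where
    right : ∀ x y → P x → P y → Right x → Right y → c x ≡ c y
    right x y px py rx ry = con₂ c (λ e p q → mono e (proj₂ p) (proj₂ q)) x y (rx , px) (ry , py)
    mono₁ : Mono (toGr G₁) (P ∘ φ₁) (c ∘ φ₁)
    mono₁ e p q with link-left (edge-link G₁ e)
    ... | inj₂ l = mono-link {H} {P} {c} mono l p q
    ... | inj₁ (inj₁ (a , b)) rewrite sym a | sym b = right u v p q u-right v-right
    ... | inj₁ (inj₂ (a , b)) rewrite sym a | sym b = right v u p q v-right u-right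
    left′ : ∀ x y → P (φ₁ x) → P (φ₁ y) → c (φ₁ x) ≡ c (φ₁ y)
    left′ x y = con₁ (c ∘ φ₁) mono₁ x y
    across : (P u ⊎ P v) ⊎ (∀ y → ¬ P (φ₂ y)) → ∀ x y → P (φ₁ x) → P (φ₂ y) → c (φ₁ x) ≡ c (φ₂ y)
    across (inj₁ (inj₁ pu)) x y px py = trans (left′ x u₁ px pu) (right u (φ₂ y) pu py u-right (y , refl))
    across (inj₁ (inj₂ pv)) x y px py = trans (left′ x v₁ px pv) (right v (φ₂ y) pv py v-right (y , refl))
    across (inj₂ none) x y px py = ⊥-elim (none y py)
    compare : ∀ x y → P x → P y → (∃[ a ] φ₁ a ≡ x) ⊎ (∃[ b ] φ₂ b ≡ x) →
      (∃[ a ] φ₁ a ≡ y) ⊎ (∃[ b ] φ₂ b ≡ y) → c x ≡ c y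
    compare _ _ px py (inj₁ (a , refl)) (inj₁ (b , refl)) = left′ a b px py
    compare _ _ px py (inj₁ (a , refl)) (inj₂ (b , refl)) = across anchor a b px py
    compare _ _ px py (inj₂ (a , refl)) (inj₁ (b , refl)) = sym (across anchor b a py px)
    compare _ _ px py (inj₂ a) (inj₂ b) = right _ _ px py a b

  TC-left : TC H → TC G₁
  TC-left tc = record
    { loopFree = lf₁ ; distinct = u₁ , v₁ , lf₁ e₁
    ; whole = conn-left (λ _ → yes tt) (TC.whole tc)
    ; minus = λ w → conn-resp {P = λ x → φ₁ x ≢ φ₁ w} (_∘ cong φ₁) (λ ne → ne ∘ φ₁-inj _ _)
        (conn-left (_≢? φ₁ w) (TC.minus tc (φ₁ w))) }

  edge-sum : (w : Fin (m H) → ℕ) (w₁ : Fin (m G₁) → ℕ) (w₂ : Fin (m G₂) → ℕ) →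
    (∀ f → w (Inverse.to ψ (inj₁ f)) ≡ w₁ (proj₁ f)) →
    (∀ f → w (Inverse.to ψ (inj₂ f)) ≡ w₂ (proj₁ f)) →
    sumF w + (w₁ e₁ + w₂ e₂) ≡ sumF w₁ + sumF w₂
  edge-sum w w₁ w₂ agree₁ agree₂ = trans (cong (_+ (w₁ e₁ + w₂ e₂))
      (trans (sym (sumF-cong (λ h → left+swap (Inverse.from ψ h) (w h)))) (sumF-+ part₁ part₂)))
    (trans (interchange (sumF part₁) (sumF part₂) (w₁ e₁) (w₂ e₂)) (cong₂ _+_
      (sum-left e₁ ψ w w₁ agree₁) (sum-left e₂ (⊎-swap-↔ ψ) w w₂ agree₂)))
    where
    part₁ part₂ : Fin (m H) → ℕ
    part₁ h = left (Inverse.from ψ h) (w h)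
    part₂ h = left (swap (Inverse.from ψ h)) (w h)
    interchange : ∀ a b c d → (a + b) + (c + d) ≡ (a + c) + (b + d)
    interchange = solve-∀

  vertex-sum : (w : Fin (n H) → ℕ) → sumF w + (w u + w v) ≡ sumF (w ∘ φ₁) + sumF (w ∘ φ₂)
  vertex-sum w = trans (cong (sumF w +_) (cong₂ _+_ (sym (at u)) (sym (at v))))
    (trans (cong (sumF w +_) (sym (sumF-+ (w at′ u) (w at′ v))))
    (trans (sym (sumF-+ w _)) (trans (sumF-cong pointwise)
    (trans (sumF-+ (λ z → if does (image? φ₁ z) then w z else 0) _)
      (cong₂ _+_ (sym (sum-image φ₁ φ₁-inj w)) (sym (sum-image φ₂ φ₂-inj w)))))))
    where
    _at′_ : (Fin (n H) → ℕ) → Fin (n H) → Fin (n H) → ℕ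
    (w at′ i) z = if is i z then w z else 0
    at : ∀ i → sumF (w at′ i) ≡ w i
    at i = trans (sumF-only i (λ z ne → cong (if_then w z else 0) (is-≢ ne)))
      (cong (if_then w i else 0) (is-refl i))
    pointwise : ∀ z → w z + ((w at′ u) z + (w at′ v) z) ≡
      (if does (image? φ₁ z) then w z else 0) + (if does (image? φ₂ z) then w z else 0)
    pointwise z with image? φ₁ z | image? φ₂ z | z F.≟ u | z F.≟ v
    ... | _ | _ | yes refl | yes eq = ⊥-elim (u≢v eq)
    ... | yes _ | yes _ | yes _ | no _ = cong (w z +_) (+-identityʳ _)
    ... | yes _ | yes _ | no _ | yes _ = refl
    ... | yes (x , refl) | yes (y , eq) | no z≢u | no z≢v with shared {x} {y} (sym eq)
    ... | inj₁ p = ⊥-elim (z≢u (trans (sym eq) p))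
    ... | inj₂ p = ⊥-elim (z≢v (trans (sym eq) p))
    pointwise z | yes _ | no _ | no _ | no _ = refl
    pointwise z | no _ | yes _ | no _ | no _ = +-identityʳ _
    pointwise z | no ¬l | no ¬r | no _ | no _ with cover z
    ... | inj₁ l = ⊥-elim (¬l l)
    ... | inj₂ r = ⊥-elim (¬r r)
    pointwise z | _ | no ¬r | yes refl | no _ = ⊥-elim (¬r u-right)
    pointwise z | _ | no ¬r | no _ | yes refl = ⊥-elim (¬r v-right)
    pointwise z | no ¬l | _ | yes refl | no _ = ⊥-elim (¬l (u₁ , refl))
    pointwise z | no ¬l | _ | no _ | yes refl = ⊥-elim (¬l (v₁ , refl))

  sizes : ∀ S → size S + (𝟙 (S u) + 𝟙 (S v)) ≡ size (S ∘ φ₁) + size (S ∘ φ₂)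
  sizes S = vertex-sum (𝟙 ∘ S)

  -- The edges `e₁` and `e₂` are both missing in `H`, and each is counted on its side exactly if `S`
  -- contains `u` and `v`.
  edge-counts : ∀ S → edges H S + (𝟙 (S u ∧ S v) + 𝟙 (S u ∧ S v)) ≡
    edges G₁ (S ∘ φ₁) + edges G₂ (S ∘ φ₂)
  edge-counts S = trans (cong (λ b → edges H S + (𝟙 (S u ∧ S v) + 𝟙 b)) (sym (uEq-both id (φ₂-u₂-v₂ {S}))))
    (edge-sum (𝟙 ∘ inE H S) (𝟙 ∘ inE G₁ (S ∘ φ₁)) (𝟙 ∘ inE G₂ (S ∘ φ₂))
      (λ f → cong 𝟙 (uEq-both S (ψ-ends₁ f))) (λ f → cong 𝟙 (uEq-both S (ψ-ends₂ f))))

  TightSet : (G : MGraph) → Subset (n G) → Set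
  TightSet G S = edges G S + 3 ≡ 2 * size S

  module Small (S : Subset (n H)) (not-both : S u ∧ S v ≡ false)
    (small : ∀ y → S (φ₂ y) ≡ true → φ₂ y ≡ u ⊎ φ₂ y ≡ v) where

    not-both₂ : S (φ₂ u₂) ∧ S (φ₂ v₂) ≡ false
    not-both₂ = trans (uEq-both id (φ₂-u₂-v₂ {S})) not-both

    small-size : size (S ∘ φ₂) ≡ 𝟙 (S u) + 𝟙 (S v)
    small-size = trans (sumF-two (lf₂ e₂) off) commute
      where
      off : ∀ y → y ≢ u₂ → y ≢ v₂ → 𝟙 (S (φ₂ y)) ≡ 0
      off y y≢u y≢v with true⊎false (S (φ₂ y))
      ... | inj₂ eq = cong 𝟙 eq
      ... | inj₁ eq with φ₂-end (small y eq)
      ... | inj₁ p = ⊥-elim (y≢u p)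
      ... | inj₂ p = ⊥-elim (y≢v p)
      commute : 𝟙 (S (φ₂ u₂)) + 𝟙 (S (φ₂ v₂)) ≡ 𝟙 (S u) + 𝟙 (S v)
      commute with φ₂-u₂-v₂ {S}
      ... | inj₁ (p , q) = cong₂ _+_ (cong 𝟙 p) (cong 𝟙 q)
      ... | inj₂ (p , q) = trans (cong₂ _+_ (cong 𝟙 p) (cong 𝟙 q)) (+-comm (𝟙 (S v)) _)

    small-edges : edges G₂ (S ∘ φ₂) ≡ 0
    small-edges = sumF-0 none
      where
      none : ∀ e → 𝟙 (inE G₂ (S ∘ φ₂) e) ≡ 0
      none e with true⊎false (inE G₂ (S ∘ φ₂) e)
      ... | inj₂ eq = cong 𝟙 eq
      ... | inj₁ eq with ∧-true {S (φ₂ (proj₁ (endsG G₂ e)))} eq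
      ... | p , q with φ₂-end (small _ p) | φ₂-end (small _ q)
      ... | inj₁ a | inj₁ b = ⊥-elim (lf₂ e (trans a (sym b)))
      ... | inj₂ a | inj₂ b = ⊥-elim (lf₂ e (trans a (sym b)))
      ... | inj₁ a | inj₂ b = ⊥-elim (true≢false (trans (sym (cong₂ (λ x y → S (φ₂ x) ∧ S (φ₂ y)) a b)) eq) not-both₂)
      ... | inj₂ a | inj₁ b = ⊥-elim (true≢false (trans (∧-comm (S (φ₂ u₂)) _)
        (trans (sym (cong₂ (λ x y → S (φ₂ x) ∧ S (φ₂ y)) a b)) eq)) not-both₂)

    size-left : size S ≡ size (S ∘ φ₁)
    size-left = +-cancelʳ-≡ (𝟙 (S u) + 𝟙 (S v)) _ _ (trans (sizes S) (cong (size (S ∘ φ₁) +_) small-size))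

    edges-left : edges H S ≡ edges G₁ (S ∘ φ₁)
    edges-left = trans (sym (+-identityʳ _)) (trans (sym (cong (λ b → edges H S + (𝟙 b + 𝟙 b)) not-both))
      (trans (edge-counts S) (trans (cong (edges G₁ (S ∘ φ₁) +_) small-edges) (+-identityʳ _))))

  module Full (S : Subset (n H)) (full : ∀ y → S (φ₂ y) ≡ true) (count₂ : m G₂ + 2 ≡ 2 * n G₂) where

    private
      Su : S u ≡ true
      Su = trans (cong S (sym (proj₂ u-right))) (full _)
      Sv : S v ≡ true
      Sv = trans (cong S (sym (proj₂ v-right))) (full _)

      full-size : size S + 2 ≡ size (S ∘ φ₁) + n G₂
      full-size = trans (sym (cong₂ (λ a b → size S + (𝟙 a + 𝟙 b)) Su Sv))
        (trans (sizes S) (cong (size (S ∘ φ₁) +_) (size-all full)))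

      full-edges : edges H S + 2 ≡ edges G₁ (S ∘ φ₁) + m G₂
      full-edges = trans (sym (cong (λ b → edges H S + (𝟙 b + 𝟙 b)) (cong₂ _∧_ Su Sv)))
        (trans (edge-counts S) (cong (edges G₁ (S ∘ φ₁) +_) (size-all (λ e → cong₂ _∧_ (full _) (full _)))))

      -- The defect |E(S)| + 3 - 2|S| is the same in `H` and in `G₁`, written without subtraction:
      -- adding the whole of `G₂` contributes m₂ - 2 edges and n₂ - 2 vertices, and m₂ - 2 = 2(n₂ -
      -- 2). One equation thus serves both directions.
      both-sides : edges H S + 3 + (2 * size (S ∘ φ₁) + 1) ≡ 2 * size S + (edges G₁ (S ∘ φ₁) + 3 + 1)
      both-sides = +-cancelʳ-≡ (m G₂ + 2) _ _ (arith (edges H S) (size S)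
        (edges G₁ (S ∘ φ₁)) (size (S ∘ φ₁)) (m G₂) (n G₂) full-edges full-size count₂)
        where
        arith : ∀ e s e₁ s₁ m n → e + 2 ≡ e₁ + m → s + 2 ≡ s₁ + n → m + 2 ≡ 2 * n →
          e + 3 + (2 * s₁ + 1) + (m + 2) ≡ 2 * s + (e₁ + 3 + 1) + (m + 2)
        arith e s e₁ s₁ m n p q r = begin
          e + 3 + (2 * s₁ + 1) + (m + 2)    ≡⟨ cong (e + 3 + (2 * s₁ + 1) +_) r ⟩
          e + 3 + (2 * s₁ + 1) + 2 * n      ≡⟨ A e s₁ n ⟩
          (e + 2) + 2 + 2 * (s₁ + n)        ≡⟨ cong₂ (λ a b → a + 2 + 2 * b) p (sym q) ⟩
          (e₁ + m) + 2 + 2 * (s + 2)        ≡⟨ B e₁ m s ⟩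
          2 * s + (e₁ + 3 + 1) + (m + 2)    ∎
          where
          open ≡-Reasoning
          A : ∀ e s₁ n → e + 3 + (2 * s₁ + 1) + 2 * n ≡ (e + 2) + 2 + 2 * (s₁ + n)
          A = solve-∀
          B : ∀ e₁ m s → (e₁ + m) + 2 + 2 * (s + 2) ≡ 2 * s + (e₁ + 3 + 1) + (m + 2)
          B = solve-∀

    tight-up : TightSet G₁ (S ∘ φ₁) → TightSet H S
    tight-up t = +-cancelʳ-≡ (2 * size (S ∘ φ₁) + 1) _ _
      (trans both-sides (cong (λ a → 2 * size S + (a + 1)) t))

    tight-down : TightSet H S → TightSet G₁ (S ∘ φ₁)
    tight-down t = sym (+-cancelʳ-≡ 1 _ _ (+-cancelˡ-≡ (edges H S + 3) _ _
      (trans both-sides (cong (_+ (edges G₁ (S ∘ φ₁) + 3 + 1)) (sym t)))))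

-- From good flats of the glued graph to good flats of a side.

module Tightness {G₁ G₂ H : MGraph} (g : Glue G₁ G₂ H) (lf₁ : LoopFree G₁) (lf₂ : LoopFree G₂) where

  open Glued g lf₁ lf₂ public

  good-left : ∀ {S} → Ind H S → Conn (toGr H) (Out S) →
    (Σ[ x ∈ Fin (n G₁) ] Σ[ y ∈ Fin (n G₁) ] (x ≢ y × S (φ₁ x) ≡ true × S (φ₁ y) ≡ true)) →
    (∃[ x ] S (φ₁ x) ≡ false) → Good G₁ (S ∘ φ₁)
  good-left {S} ind con two proper = proper , record
    { distinct = two
    ; whole = conn-left (λ x → S x 𝔹.≟ true) (Ind.whole ind)
    ; minus = λ w → conn-resp {P = InMinus S (φ₁ w) ∘ φ₁}
        (λ (p , q) → p , q ∘ cong φ₁) (λ (p , q) → p , q ∘ φ₁-inj _ _)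
        (conn-left (λ x → (S x 𝔹.≟ true) ×-dec (x ≢? φ₁ w)) (Ind.minus ind (φ₁ w))) }
    , conn-left (λ x → S x 𝔹.≟ false) con

  onLeft : Fin (n H) → Bool
  onLeft z = does (image? φ₁ z)

  onLeft-φ₁ : ∀ x → onLeft (φ₁ x) ≡ true
  onLeft-φ₁ x = dec-true (image? φ₁ (φ₁ x)) (x , refl)

  onLeft-φ₂ : ∀ y → φ₂ y ≢ u → φ₂ y ≢ v → onLeft (φ₂ y) ≡ false
  onLeft-φ₂ y y≢u y≢v = dec-false (image? φ₁ (φ₂ y)) λ { (x , eq) → off (shared {x} {y} eq) }
    where
    off : φ₂ y ≡ u ⊎ φ₂ y ≡ v → ⊥
    off (inj₁ p) = y≢u p
    off (inj₂ p) = y≢v p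

  onLeft-mono : {P : Fin (n H) → Set} → (∀ z → P z → z ≢ u × z ≢ v) → Mono (toGr H) P onLeft
  onLeft-mono away h p q with proj₁ (endsG H h) | proj₂ (endsG H h) | side h
  ... | _ | _ | on-left x y _ refl refl = trans (onLeft-φ₁ x) (sym (onLeft-φ₁ y))
  ... | _ | _ | on-right x y refl refl =
    let a , b = away _ p ; c , d = away _ q in trans (onLeft-φ₂ x a b) (sym (onLeft-φ₂ y c d))

  -- No edge of `H` passes from one side to the other except at `u` or `v`, so `onLeft` is a
  -- colouring of `P`.
  one-side : ∀ {P : Fin (n H) → Set} → (∀ z → P z → z ≢ u × z ≢ v) → Conn (toGr H) P →
    ∀ x y → P (φ₁ x) → P (φ₂ y) → ⊥
  one-side away con x y px py = true≢false
    (trans (sym (con onLeft (onLeft-mono away) (φ₁ x) (φ₂ y) px py)) (onLeft-φ₁ x))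
    (let a , b = away _ py in onLeft-φ₂ y a b)

  full-tight : Tight G₁ → m G₂ + 2 ≡ 2 * n G₂ → ∀ S → Good H S → (∀ y → S (φ₂ y) ≡ true) → TightSet H S
  full-tight ti count₂ S ((z , Sz) , ind , con) full = Full.tight-up S full count₂
    (Tight.tight ti (S ∘ φ₁) (good-left {S} ind con (u₁ , v₁ , lf₁ e₁ , at u-right , at v-right) proper))
    where
    at : ∀ {z} → (∃[ y ] φ₂ y ≡ z) → S z ≡ true
    at (y , refl) = full y
    proper : ∃[ x ] S (φ₁ x) ≡ false
    proper with cover z
    ... | inj₁ (x , refl) = x , Sz
    ... | inj₂ (y , refl) = ⊥-elim (true≢false (full y) Sz)

  small-tight : Tight G₁ → ∀ S → Good H S → S u ∧ S v ≡ false →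
    (∀ y → S (φ₂ y) ≡ true → φ₂ y ≡ u ⊎ φ₂ y ≡ v) → TightSet H S
  small-tight ti S (_ , ind , con) not-both small =
    subst₂ (λ e s → e + 3 ≡ 2 * s) (sym edges-left) (sym size-left)
      (Tight.tight ti (S ∘ φ₁) (good-left {S} ind con two proper))
    where
    open Small S not-both small
    pull : ∀ z → S z ≡ true → ∃[ x ] φ₁ x ≡ z
    pull z Sz with cover z
    ... | inj₁ l = l
    ... | inj₂ (y , refl) with small y Sz
    ... | inj₁ eq = u₁ , sym eq
    ... | inj₂ eq = v₁ , sym eq
    two : Σ[ x ∈ Fin (n G₁) ] Σ[ y ∈ Fin (n G₁) ] (x ≢ y × S (φ₁ x) ≡ true × S (φ₁ y) ≡ true)
    two with Ind.distinct ind
    ... | a , b , a≢b , Sa , Sb with pull a Sa | pull b Sb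
    ... | x , refl | y , refl = x , y , a≢b ∘ cong φ₁ , Sa , Sb
    proper : ∃[ x ] S (φ₁ x) ≡ false
    proper with S u in Su
    ... | false = u₁ , Su
    ... | true = v₁ , not-both

  glue-count : m G₁ + 2 ≡ 2 * n G₁ → m G₂ + 2 ≡ 2 * n G₂ → m H + 2 ≡ 2 * n H
  glue-count c₁ c₂ = +-cancelʳ-≡ 4 _ _ (arith (m H) (n H) (m G₁) (n G₁) (m G₂) (n G₂)
    (trans (cong (_+ 2) (sym (sumF-1 (m H)))) (trans (edge-counts (λ _ → true)) (cong₂ _+_ (sumF-1 (m G₁)) (sumF-1 (m G₂)))))
    (trans (cong (_+ 2) (sym (sumF-1 (n H)))) (trans (sizes (λ _ → true)) (cong₂ _+_ (sumF-1 (n G₁)) (sumF-1 (n G₂)))))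
    c₁ c₂)
    where
    arith : ∀ m n m₁ n₁ m₂ n₂ → m + 2 ≡ m₁ + m₂ → n + 2 ≡ n₁ + n₂ → m₁ + 2 ≡ 2 * n₁ → m₂ + 2 ≡ 2 * n₂ →
      m + 2 + 4 ≡ 2 * n + 4
    arith m n m₁ n₁ m₂ n₂ p q r s = begin
      m + 2 + 4                  ≡⟨ cong (_+ 4) p ⟩
      m₁ + m₂ + 4                ≡⟨ A m₁ m₂ ⟩
      (m₁ + 2) + (m₂ + 2)        ≡⟨ cong₂ _+_ r s ⟩
      2 * n₁ + 2 * n₂            ≡⟨ *-distribˡ-+ 2 n₁ n₂ ⟨
      2 * (n₁ + n₂)              ≡⟨ cong (2 *_) q ⟨
      2 * (n + 2)                ≡⟨ *-distribˡ-+ 2 n 2 ⟩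
      2 * n + 4                  ∎
      where
      open ≡-Reasoning
      A : ∀ a b → a + b + 4 ≡ (a + 2) + (b + 2)
      A = solve-∀

-- If `S` contains `u` and `v`, its connected complement lies on one side, so `S` contains the whole
-- other side. Otherwise `S`, apart from `u` and `v`, lies on one side. In both cases the trace of
-- `S` on a suitable side is a good flat there.
glue-tight : ∀ {G₁ G₂ H} → Glue G₁ G₂ H → LoopFree G₁ → LoopFree G₂ →
  Tight G₁ → Tight G₂ → Tight H
glue-tight {G₁} {G₂} {H} g lf₁ lf₂ ti₁ ti₂ = record
  { count = glue-count (Tight.count ti₁) (Tight.count ti₂) ; tight = tight }
  where
  open Tightness g lf₁ lf₂
  module Swapped = Tightness (glue-swap g) lf₂ lf₁

  tight : ∀ S → Good H S → TightSet H S
  tight S good@((z , Sz) , ind , con) with true⊎false (S u ∧ S v)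
  ... | inj₁ both with ∧-true {S u} both | any? (λ y → S (φ₂ y) 𝔹.≟ false)
  ... | Su , Sv | no none = full-tight ti₁ (Tight.count ti₂) S good full
    where
    full : ∀ y → S (φ₂ y) ≡ true
    full y with true⊎false (S (φ₂ y))
    ... | inj₁ eq = eq
    ... | inj₂ eq = ⊥-elim (none (y , eq))
  ... | Su , Sv | yes (y , Sy) = Swapped.full-tight ti₂ (Tight.count ti₁) S good full
    where
    full : ∀ x → S (φ₁ x) ≡ true
    full x with true⊎false (S (φ₁ x))
    ... | inj₁ eq = eq
    ... | inj₂ eq = ⊥-elim (one-side {Out S}
      (λ z Sz → (λ { refl → true≢false Su Sz }) , (λ { refl → true≢false Sv Sz })) con x y eq Sy)
  tight S good@((z , Sz) , ind , con) | inj₂ not-both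
    with any? (λ y → (S (φ₂ y) 𝔹.≟ true) ×-dec ((φ₂ y ≢? u) ×-dec (φ₂ y ≢? v)))
  ... | no none = small-tight ti₁ S good not-both small
    where
    small : ∀ y → S (φ₂ y) ≡ true → φ₂ y ≡ u ⊎ φ₂ y ≡ v
    small y Sy with φ₂ y F.≟ u | φ₂ y F.≟ v
    ... | yes p | _ = inj₁ p
    ... | no _ | yes p = inj₂ p
    ... | no p | no q = ⊥-elim (none (y , Sy , p , q))
  ... | yes (y , Sy , y≢u , y≢v) = Swapped.small-tight ti₂ S good
      (trans (uEq-both id (φ₂-u₂-v₂ {S})) not-both) small
    where
    -- Removing the one of `u` and `v` that `S` may contain leaves a set away from both, connected
    -- because `S` is 2-connected.
    crossing : ∀ x → S (φ₁ x) ≡ true → φ₁ x ≢ u → φ₁ x ≢ v → ⊥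
    crossing x Sx x≢u x≢v with true⊎false (S u)
    ... | inj₁ Su = one-side {InMinus S u} away (Ind.minus ind u) x y (Sx , x≢u) (Sy , y≢u)
      where
      away : ∀ z → InMinus S u z → z ≢ u × z ≢ v
      away z (Sz , z≢u) = z≢u , λ { refl → true≢false (cong₂ _∧_ Su Sz) not-both }
    ... | inj₂ Su = one-side {InMinus S v} away (Ind.minus ind v) x y (Sx , x≢v) (Sy , y≢v)
      where
      away : ∀ z → InMinus S v z → z ≢ u × z ≢ v
      away z (Sz , z≢v) = (λ { refl → true≢false Sz Su }) , z≢v
    small : ∀ x → S (φ₁ x) ≡ true → φ₁ x ≡ φ₂ u₂ ⊎ φ₁ x ≡ φ₂ v₂
    small x Sx with φ₁ x F.≟ u | φ₁ x F.≟ v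
    ... | yes p | _ = uEq-r glue (inj₁ p)
    ... | no _ | yes p = uEq-r glue (inj₂ p)
    ... | no p | no q = ⊥-elim (crossing x Sx p q)

-- From good flats of a side to good flats of the glued graph.

module Descend {G₁ G₂ H : MGraph} (g : Glue G₁ G₂ H) (lf₁ : LoopFree G₁) (lf₂ : LoopFree G₂)
  (tiH : Tight H) (count₂ : m G₂ + 2 ≡ 2 * n G₂)
  (whole : Conn (toGr H) (Glued.Right g lf₁ lf₂))
  (minus : ∀ w → Conn (toGr H) (λ z → Glued.Right g lf₁ lf₂ z × z ≢ w)) where

  open Tightness g lf₁ lf₂

  module _ (S : Subset (n G₁)) (good : Good G₁ S) where

    private
      ind : Ind G₁ S
      ind = proj₁ (proj₂ good)

      module Extended (b : Bool) where

        S⁺ : Subset (n H)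
        S⁺ = extend S b

        S⁺-φ₁ : ∀ x → S⁺ (φ₁ x) ≡ S x
        S⁺-φ₁ = extend-φ₁ S b

        proper : ∃[ z ] S⁺ z ≡ false
        proper = let x , Sx = proj₁ good in φ₁ x , trans (S⁺-φ₁ x) Sx

        distinct : Σ[ x ∈ Fin (n H) ] Σ[ y ∈ Fin (n H) ] (x ≢ y × S⁺ x ≡ true × S⁺ y ≡ true)
        distinct = let x , y , x≢y , Sx , Sy = Ind.distinct ind in
          φ₁ x , φ₁ y , x≢y ∘ φ₁-inj _ _ , trans (S⁺-φ₁ x) Sx , trans (S⁺-φ₁ y) Sy

        whole₁ : Conn (toGr G₁) (In S⁺ ∘ φ₁)
        whole₁ = conn-resp {P = In S} (trans (S⁺-φ₁ _)) (trans (sym (S⁺-φ₁ _))) (Ind.whole ind)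

        out₁ : Conn (toGr G₁) (Out S⁺ ∘ φ₁)
        out₁ = conn-resp {P = Out S} (trans (S⁺-φ₁ _)) (trans (sym (S⁺-φ₁ _))) (proj₂ (proj₂ good))

        minus₁ : ∀ z → Conn (toGr G₁) (InMinus S⁺ z ∘ φ₁)
        minus₁ z with image? φ₁ z
        ... | yes (w , refl) = conn-resp {P = InMinus S w}
          (λ (p , q) → trans (S⁺-φ₁ _) p , q ∘ φ₁-inj _ _)
          (λ (p , q) → trans (sym (S⁺-φ₁ _)) p , q ∘ cong φ₁) (Ind.minus ind w)
        ... | no none = conn-resp {P = In S⁺ ∘ φ₁} (λ p → p , λ eq → none (_ , eq)) proj₁ whole₁

        to-S : TightSet G₁ (S⁺ ∘ φ₁) → TightSet G₁ S
        to-S = subst₂ (λ e s → e + 3 ≡ 2 * s) (edges-cong G₁ S⁺-φ₁) (size-cong S⁺-φ₁)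

    -- `S⁺` is `S` with the whole right side added, which replaces the edge `e₁` in connections
    -- within `S`. The complement stays that of `S`, so connections there do not pass through `e₁`.
    both-tight : S u₁ ≡ true → S v₁ ≡ true → TightSet G₁ S
    both-tight Su Sv = to-S (Full.tight-down S⁺ full count₂ (Tight.tight tiH S⁺ (proper , ind⁺ , out⁺)))
      where
      open Extended true
      full : ∀ y → S⁺ (φ₂ y) ≡ true
      full y = extend-φ₂ S true y (λ _ → Su) (λ _ → Sv)
      on-right-in : ∀ {z} → Right z → S⁺ z ≡ true
      on-right-in (y , refl) = full y
      anchor : ∀ w → (InMinus S⁺ w u ⊎ InMinus S⁺ w v) ⊎ (∀ y → ¬ InMinus S⁺ w (φ₂ y))
      anchor w with u F.≟ w
      ... | yes refl = inj₁ (inj₂ (on-right-in v-right , u≢v ∘ sym))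
      ... | no u≢w = inj₁ (inj₁ (on-right-in u-right , u≢w))
      ind⁺ : Ind H S⁺
      ind⁺ = record
        { distinct = distinct
        ; whole = conn-glue whole₁ (conn-resp {P = Right} (λ r → r , on-right-in r) proj₁ whole)
            (inj₁ (inj₁ (on-right-in u-right)))
        ; minus = λ w → conn-glue (minus₁ w)
            (conn-resp {P = λ z → Right z × z ≢ w} (λ (r , p) → r , on-right-in r , p) (λ (r , _ , p) → r , p)
              (minus w)) (anchor w) }
      out⁺ : Conn (toGr H) (Out S⁺)
      out⁺ = conn-glue out₁ (λ c mono x y (r , p) _ → ⊥-elim (true≢false (on-right-in r) p))
        (inj₂ (λ y → true≢false (full y)))

    -- `S⁺` is the image of `S`, and `e₁` is not an edge inside it. Its complement gains the right
    -- side without the vertex of `S` among `u` and `v`, if there is one; that part is connected by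
    -- `minus` or `whole` and meets the left part in the other vertex.
    not-both-tight : S u₁ ∧ S v₁ ≡ false → TightSet G₁ S
    not-both-tight not-both = to-S (subst₂ (λ e s → e + 3 ≡ 2 * s) edges-left size-left
        (Tight.tight tiH S⁺ (proper , ind⁺ , out⁺)))
      where
      open Extended false
      not-both⁺ : S⁺ u ∧ S⁺ v ≡ false
      not-both⁺ = trans (cong₂ _∧_ (S⁺-φ₁ u₁) (S⁺-φ₁ v₁)) not-both
      small : ∀ y → S⁺ (φ₂ y) ≡ true → φ₂ y ≡ u ⊎ φ₂ y ≡ v
      small y Sy with φ₂ y F.≟ u | φ₂ y F.≟ v
      ... | yes p | _ = inj₁ p
      ... | no _ | yes p = inj₂ p
      ... | no p | no q = ⊥-elim (true≢false Sy
        (extend-φ₂ S false y (λ eq → ⊥-elim (p eq)) (λ eq → ⊥-elim (q eq))))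
      open Small S⁺ not-both⁺ small

      single : {P : Fin (n H) → Set} → (∀ z → P z → S⁺ z ≡ true) → Conn (toGr H) (λ z → Right z × P z)
      single P⊆S c mono x y ((a , refl) , px) ((b , refl) , py)
        with small a (P⊆S _ px) | small b (P⊆S _ py)
      ... | inj₁ p | inj₁ q = cong c (trans p (sym q))
      ... | inj₂ p | inj₂ q = cong c (trans p (sym q))
      ... | inj₁ p | inj₂ q = ⊥-elim (true≢false
        (cong₂ _∧_ (trans (cong S⁺ (sym p)) (P⊆S _ px)) (trans (cong S⁺ (sym q)) (P⊆S _ py))) not-both⁺)
      ... | inj₂ p | inj₁ q = ⊥-elim (true≢false
        (cong₂ _∧_ (trans (cong S⁺ (sym q)) (P⊆S _ py)) (trans (cong S⁺ (sym p)) (P⊆S _ px))) not-both⁺)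

      anchor : {P : Fin (n H) → Set} → (∀ z → P z → S⁺ z ≡ true) → (∀ z → Dec (P z)) →
        (P u ⊎ P v) ⊎ (∀ y → ¬ P (φ₂ y))
      anchor {P} P⊆S P? with P? u | P? v
      ... | yes pu | _ = inj₁ (inj₁ pu)
      ... | no _ | yes pv = inj₁ (inj₂ pv)
      ... | no ¬pu | no ¬pv = inj₂ none
        where
        none : ∀ y → ¬ P (φ₂ y)
        none y py with small y (P⊆S _ py)
        ... | inj₁ eq = ¬pu (subst P eq py)
        ... | inj₂ eq = ¬pv (subst P eq py)

      ind⁺ : Ind H S⁺
      ind⁺ = record
        { distinct = distinct
        ; whole = conn-glue whole₁ (single (λ _ → id)) (anchor (λ _ → id) (λ z → S⁺ z 𝔹.≟ true))
        ; minus = λ w → conn-glue (minus₁ w) (single (λ _ → proj₁))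
            (anchor (λ _ → proj₁) (λ z → (S⁺ z 𝔹.≟ true) ×-dec (z ≢? w))) }

      out⁺ : Conn (toGr H) (Out S⁺)
      out⁺ with true⊎false (S⁺ u) | true⊎false (S⁺ v)
      ... | inj₁ Su | inj₁ Sv = ⊥-elim (true≢false (cong₂ _∧_ Su Sv) not-both⁺)
      ... | inj₁ Su | inj₂ Sv = conn-glue out₁
        (conn-resp {P = λ z → Right z × z ≢ u} (λ (r , p) → r , to r p)
          (λ (r , p) → r , λ { refl → true≢false Su p }) (minus u)) (inj₁ (inj₂ Sv))
        where
        to : ∀ {z} → Right z → z ≢ u → S⁺ z ≡ false
        to (y , refl) y≢u with true⊎false (S⁺ (φ₂ y))
        ... | inj₂ eq = eq
        ... | inj₁ eq with small y eq
        ... | inj₁ p = ⊥-elim (y≢u p)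
        ... | inj₂ p = trans (cong S⁺ p) Sv
      ... | inj₂ Su | inj₁ Sv = conn-glue out₁
        (conn-resp {P = λ z → Right z × z ≢ v} (λ (r , p) → r , to r p)
          (λ (r , p) → r , λ { refl → true≢false Sv p }) (minus v)) (inj₁ (inj₁ Su))
        where
        to : ∀ {z} → Right z → z ≢ v → S⁺ z ≡ false
        to (y , refl) y≢v with true⊎false (S⁺ (φ₂ y))
        ... | inj₂ eq = eq
        ... | inj₁ eq with small y eq
        ... | inj₁ p = trans (cong S⁺ p) Su
        ... | inj₂ p = ⊥-elim (y≢v p)
      ... | inj₂ Su | inj₂ Sv = conn-glue out₁
        (conn-resp {P = Right} (λ r → r , to r) proj₁ whole) (inj₁ (inj₁ Su))
        where
        to : ∀ {z} → Right z → S⁺ z ≡ false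
        to (y , refl) with true⊎false (S⁺ (φ₂ y))
        ... | inj₂ eq = eq
        ... | inj₁ eq with small y eq
        ... | inj₁ p = trans (cong S⁺ p) Su
        ... | inj₂ p = trans (cong S⁺ p) Sv

  tight-left : m G₁ + 2 ≡ 2 * n G₁ → Tight G₁
  tight-left count₁ = record { count = count₁ ; tight = λ S good → by-cases S good (true⊎false _) }
    where
    by-cases : ∀ S → Good G₁ S → S u₁ ∧ S v₁ ≡ true ⊎ S u₁ ∧ S v₁ ≡ false → TightSet G₁ S
    by-cases S good (inj₁ both) = let Su , Sv = ∧-true {S u₁} both in both-tight S good Su Sv
    by-cases S good (inj₂ not-both) = not-both-tight S good not-both

-- Splitting along a 2-vertex cut

-- The vertices and edges of an `MGraph` are numbered, so a subset has to be renumbered before it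
-- can carry a graph.
record Enumeration (S : Subset k) : Set where
  field
    len    : ℕ
    len≡   : len ≡ size S
    at     : Fin len → Fin k
    at-in  : ∀ i → S (at i) ≡ true
    at-inj : ∀ i j → at i ≡ at j → i ≡ j
    index  : ∀ x → S x ≡ true → ∃[ i ] at i ≡ x

enumerate : (S : Subset k) → Enumeration S
enumerate {zero} S = record
  { len = 0 ; len≡ = refl ; at = λ () ; at-in = λ () ; at-inj = λ () ; index = λ () }
enumerate {suc k} S with true⊎false (S zero) | enumerate (S ∘ suc)
... | inj₁ eq | tail = record
  { len = suc len ; len≡ = cong₂ _+_ (sym (cong 𝟙 eq)) len≡
  ; at = λ { zero → zero ; (suc i) → suc (at i) }
  ; at-in = λ { zero → eq ; (suc i) → at-in i }
  ; at-inj = λ { zero zero _ → refl ; (suc i) (suc j) p → cong suc (at-inj i j (suc-injective p)) }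
  ; index = λ { zero _ → zero , refl
              ; (suc x) Sx → let i , p = index x Sx in suc i , cong suc p } }
  where open Enumeration tail
... | inj₂ eq | tail = record
  { len = len ; len≡ = trans len≡ (cong (_+ size (S ∘ suc)) (sym (cong 𝟙 eq)))
  ; at = suc ∘ at
  ; at-in = at-in
  ; at-inj = λ i j p → at-inj i j (suc-injective p)
  ; index = λ { zero Sx → ⊥-elim (true≢false Sx eq)
              ; (suc x) Sx → let i , p = index x Sx in i , cong suc p } }
  where open Enumeration tail

module SideGraph (G : MGraph) (A : Subset (n G)) {u v : Fin (n G)}
  (Au : A u ≡ true) (Av : A v ≡ true) where

  open Enumeration (enumerate A) public
    using () renaming (len to #V; len≡ to #V≡; at to φ; at-in to φ-in; at-inj to φ-inj; index to φ⁻¹)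
  open Enumeration (enumerate (inE G A)) public
    using () renaming (len to #E; len≡ to #E≡; at to edge; at-in to edge-in; at-inj to edge-inj; index to edge⁻¹)

  inside : ∀ j → A (proj₁ (endsG G (edge j))) ≡ true × A (proj₂ (endsG G (edge j))) ≡ true
  inside j = ∧-true {A (proj₁ (endsG G (edge j)))} (edge-in j)

  sideEnds : Fin (suc #E) → Fin #V × Fin #V
  -- Index `zero` is the additional edge that Construction A deletes again.
  sideEnds zero = proj₁ (φ⁻¹ u Au) , proj₁ (φ⁻¹ v Av)
  sideEnds (suc j) = proj₁ (φ⁻¹ _ (proj₁ (inside j))) , proj₁ (φ⁻¹ _ (proj₂ (inside j)))

  sideGraph : MGraph
  sideGraph = record { n = #V ; m = suc #E ; ends = sideEnds }

  φ-u : φ (proj₁ (sideEnds zero)) ≡ u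
  φ-u = proj₂ (φ⁻¹ u Au)

  φ-v : φ (proj₂ (sideEnds zero)) ≡ v
  φ-v = proj₂ (φ⁻¹ v Av)

  φ-ends : ∀ j → UEq (endsG G (edge j)) (mapPair φ (sideEnds (suc j)))
  φ-ends j = inj₁ (sym (proj₂ (φ⁻¹ _ (proj₁ (inside j)))) , sym (proj₂ (φ⁻¹ _ (proj₂ (inside j)))))

  sideLoopFree : LoopFree G → u ≢ v → LoopFree sideGraph
  sideLoopFree lf u≢v zero eq = u≢v (trans (sym φ-u) (trans (cong φ eq) φ-v))
  sideLoopFree lf u≢v (suc j) eq = lf (edge j)
    (trans (sym (proj₂ (φ⁻¹ _ (proj₁ (inside j))))) (trans (cong φ eq) (proj₂ (φ⁻¹ _ (proj₂ (inside j))))))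

  -- The additional edge absorbs one unit: the equation of a good flat becomes the count of a whole
  -- graph.
  sideCount : edges G A + 3 ≡ 2 * size A → m sideGraph + 2 ≡ 2 * n sideGraph
  sideCount t rewrite #E≡ | #V≡ = trans (sym (+-suc (edges G A) 2)) t

  conn-image : {P : Fin (n G) → Set} → Conn (toGr G) (λ z → A z ≡ true × P z) →
    Conn (toGr G) (λ z → (∃[ x ] φ x ≡ z) × P z)
  conn-image = conn-resp (λ (p , q) → φ⁻¹ _ p , q) (λ { ((x , refl) , q) → φ-in x , q })

module Decompose {G : MGraph} (tc : TC G) (ti : Tight G) {u v : Fin (n G)} (u≢v : u ≢ v)
  (c : Fin (n G) → Bool) (mono : Mono (toGr G) (Out (pair u v)) c)
  {x y : Fin (n G)} (x-out : pair u v x ≡ false) (y-out : pair u v y ≡ false)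
  (cx : c x ≡ true) (cy : c y ≡ false) where

  open Separation tc ti u≢v c mono x-out y-out cx cy
  module 𝓛 = SideGraph G L {u} {v} (core⊆L u (pair-l u v)) (core⊆L v (pair-r u v))
  module 𝓡 = SideGraph G R {u} {v} (core⊆R u (pair-l u v)) (core⊆R v (pair-r u v))

  G₁ G₂ : MGraph
  G₁ = 𝓛.sideGraph
  G₂ = 𝓡.sideGraph

  private
    -- An edge inside both sides would join `u` and `v`. Hence each edge of `G` belongs to exactly
    -- one side, which makes `to` a bijection.
    not-in-both : ∀ e → inE G L e ≡ true → inE G R e ≡ true → ⊥
    not-in-both e p q = <⇒≱ (≤-reflexive (cong suc non-adjacent))
      (size-≥1 {S = inE G (pair u v)} e (trans (edge-inter e) (cong₂ _∧_ p q)))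

    Edges : Set
    Edges = (Σ[ f ∈ Fin (m G₁) ] T (not (does (f F.≟ zero)))) ⊎
            (Σ[ f ∈ Fin (m G₂) ] T (not (does (f F.≟ zero))))

    to : Edges → Fin (m G)
    to (inj₁ (suc j , _)) = 𝓛.edge j
    to (inj₂ (suc j , _)) = 𝓡.edge j

    locate : ∀ h → inE G L h ≡ true ⊎ inE G R h ≡ true
    locate h = ∨-true {inE G L h} (sym (edge-union h))

    preimage : ∀ h → Σ[ z ∈ Edges ] to z ≡ h
    preimage h with locate h
    ... | inj₁ p = let j , eq = 𝓛.edge⁻¹ h p in inj₁ (suc j , tt) , eq
    ... | inj₂ p = let j , eq = 𝓡.edge⁻¹ h p in inj₂ (suc j , tt) , eq

    to-injective : ∀ a b → to a ≡ to b → a ≡ b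
    to-injective (inj₁ (suc i , _)) (inj₁ (suc j , _)) eq = cong (λ i → inj₁ (suc i , tt)) (𝓛.edge-inj i j eq)
    to-injective (inj₂ (suc i , _)) (inj₂ (suc j , _)) eq = cong (λ i → inj₂ (suc i , tt)) (𝓡.edge-inj i j eq)
    to-injective (inj₁ (suc i , _)) (inj₂ (suc j , _)) eq =
      ⊥-elim (not-in-both _ (𝓛.edge-in i) (subst (λ h → inE G R h ≡ true) (sym eq) (𝓡.edge-in j)))
    to-injective (inj₂ (suc i , _)) (inj₁ (suc j , _)) eq =
      ⊥-elim (not-in-both _ (𝓛.edge-in j) (subst (λ h → inE G R h ≡ true) eq (𝓡.edge-in i)))

    cover : ∀ z → (∃[ x ] 𝓛.φ x ≡ z) ⊎ (∃[ y ] 𝓡.φ y ≡ z)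
    cover z = ⊎-map (𝓛.φ⁻¹ z) (𝓡.φ⁻¹ z) (∨-true {L z} (sym (union z)))

    only-glue : ∀ x y → 𝓛.φ x ≡ 𝓡.φ y →
      (x ≡ proj₁ (𝓛.sideEnds zero)) ⊎ (x ≡ proj₂ (𝓛.sideEnds zero))
    only-glue x y eq = ⊎-map (λ p → 𝓛.φ-inj _ _ (trans p (sym 𝓛.φ-u))) (λ p → 𝓛.φ-inj _ _ (trans p (sym 𝓛.φ-v)))
      (pair-cases u v (𝓛.φ x) (trans (inter (𝓛.φ x))
        (cong₂ _∧_ (𝓛.φ-in x) (subst (λ z → R z ≡ true) (sym eq) (𝓡.φ-in y)))))

  glued : Glue G₁ G₂ G
  glued = record
    { e₁ = zero ; e₂ = zero ; φ₁ = 𝓛.φ ; φ₂ = 𝓡.φ ; φ₁-inj = 𝓛.φ-inj ; φ₂-inj = 𝓡.φ-inj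
    ; cover = cover
    ; glue = inj₁ (trans 𝓛.φ-u (sym 𝓡.φ-u) , trans 𝓛.φ-v (sym 𝓡.φ-v))
    ; only-glue = only-glue
    ; ψ = mk↔ₛ′ to (proj₁ ∘ preimage) (proj₂ ∘ preimage) (λ z → to-injective _ z (proj₂ (preimage (to z))))
    ; ψ-ends₁ = λ { (suc j , _) → 𝓛.φ-ends j }
    ; ψ-ends₂ = λ { (suc j , _) → 𝓡.φ-ends j } }

  private
    lf₁ : LoopFree G₁
    lf₁ = 𝓛.sideLoopFree (TC.loopFree tc) u≢v
    lf₂ : LoopFree G₂
    lf₂ = 𝓡.sideLoopFree (TC.loopFree tc) u≢v

    count₁ : m G₁ + 2 ≡ 2 * n G₁
    count₁ = 𝓛.sideCount (proj₂ tightL)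
    count₂ : m G₂ + 2 ≡ 2 * n G₂
    count₂ = 𝓡.sideCount (proj₂ tightR)

    indL : Ind G L
    indL = proj₁ (proj₁ tightL)
    indR : Ind G R
    indR = proj₁ (proj₁ tightR)

  tc₁ : TC G₁
  tc₁ = Glued.TC-left glued lf₁ lf₂ tc

  tc₂ : TC G₂
  tc₂ = Glued.TC-left (glue-swap glued) lf₂ lf₁ tc

  tight₁ : Tight G₁
  tight₁ = Descend.tight-left glued lf₁ lf₂ ti count₂
    (conn-resp {P = λ z → (∃[ x ] 𝓡.φ x ≡ z) × ⊤} proj₁ (_, tt)
      (𝓡.conn-image (conn-resp {P = In R} (_, tt) proj₁ (Ind.whole indR))))
    (λ w → 𝓡.conn-image (Ind.minus indR w)) count₁

  tight₂ : Tight G₂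
  tight₂ = Descend.tight-left (glue-swap glued) lf₂ lf₁ ti count₁
    (conn-resp {P = λ z → (∃[ x ] 𝓛.φ x ≡ z) × ⊤} proj₁ (_, tt)
      (𝓛.conn-image (conn-resp {P = In L} (_, tt) proj₁ (Ind.whole indL))))
    (λ w → 𝓛.conn-image (Ind.minus indL w)) count₂

  constrA : ConstrA 2 G₁ G₂ G
  constrA = record
    { tc₁ = TC⇒twoConn tc₁ ; tc₂ = TC⇒twoConn tc₂ ; e₁ = e₁ ; e₂ = e₂
    ; w₁ = (λ _ → refl) , (λ _ → refl) , DeleteContract.delete⊎contract tc₁ e₁ (tight⇒2≤m tc₁ tight₁)
    ; w₂ = (λ _ → refl) , (λ _ → refl) , DeleteContract.delete⊎contract tc₂ e₂ (tight⇒2≤m tc₂ tight₂)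
    ; φ₁ = φ₁ ; φ₂ = φ₂ ; φ₁-inj = φ₁-inj ; φ₂-inj = φ₂-inj
    ; cover = Glue.cover glued ; glue = glue ; only-glue = Glue.only-glue glued
    ; ψ = ψ ; ψ-ends₁ = ψ-ends₁ ; ψ-ends₂ = ψ-ends₂ }
    where open Glue glued hiding (cover; only-glue)

  private
    size-true : size {n G} (λ _ → true) ≡ n G
    size-true = size-all {S = λ _ → true} (λ _ → refl)

  n₁<n : n G₁ < n G
  n₁<n = subst₂ _<_ (sym 𝓛.#V≡) size-true L<Q

  n₂<n : n G₂ < n G
  n₂<n = subst₂ _<_ (sym 𝓡.#V≡) size-true R<Q

  -- Besides `u` and `v` the side contains `x`. So the two-vertex graph never arises in the
  -- recursion, which can end only at `K₄`.
  3≤n₁ : 3 ≤ n G₁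
  3≤n₁ = subst₂ _<_ (size-pair u≢v) (sym 𝓛.#V≡) (size-< core⊆L x x-out Lx)

  3≤n₂ : 3 ≤ n G₂
  3≤n₂ = subst₂ _<_ (size-pair u≢v) (sym 𝓡.#V≡) (size-< core⊆R y y-out Ry)

-- Induction on the number of vertices, and the equivalence.

TwoCut : MGraph → Set
TwoCut G = Σ[ u ∈ Fin (n G) ] Σ[ v ∈ Fin (n G) ] (u ≢ v × Cut (toGr G) (Out (pair u v)))

twoCut? : ∀ G → TwoCut G ⊎ (∀ u v → u ≢ v → Conn (toGr G) (Out (pair u v)))
twoCut? G = choose λ u → choose λ v → decide u v
  where
  decide : ∀ u v → (u ≢ v × Cut (toGr G) (Out (pair u v))) ⊎ (u ≢ v → Conn (toGr G) (Out (pair u v)))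
  decide u v with u F.≟ v | conn⊎cut G (λ x → pair u v x 𝔹.≟ false)
  ... | yes eq | _ = inj₂ (λ ne → ⊥-elim (ne eq))
  ... | no ne | inj₁ con = inj₂ (λ _ → con)
  ... | no ne | inj₂ cut = inj₁ (ne , cut)

tight⇒class : ∀ fuel G → n G < fuel → TC G → Tight G → 3 ≤ n G → ClassA 2 G
tight⇒class (suc fuel) G (s≤s le) tc ti 3≤n with twoCut? G
... | inj₂ conn = base (ThreeConnected.isK₄ tc ti 3≤n conn)
... | inj₁ (u , v , u≢v , c , mono , x , y , x-out , y-out , cx , cy) = step
    (tight⇒class fuel G₁ (≤-trans n₁<n le) tc₁ tight₁ 3≤n₁)
    (tight⇒class fuel G₂ (≤-trans n₂<n le) tc₂ tight₂ 3≤n₂) constrA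
  where open Decompose tc ti u≢v c mono x-out y-out cx cy

class⇒tight : ∀ {G} → ClassA 2 G → Tight G
class⇒tight (base k₄) = K₄⇒tight k₄
class⇒tight (step a b C) = glue-tight (constrA⇒glue C) (proj₁ (ConstrA.tc₁ C)) (proj₁ (ConstrA.tc₂ C))
  (class⇒tight a) (class⇒tight b)

theorem2p25 : (G : MGraph) → TwoConn (toGr G) →
    (Spade 2 G ⇔ (IsC2 G ⊎ ClassA 2 G))
theorem2p25 G twoConn = mk⇔ (forward ∘ spade⇒tight tc) (tight⇒spade tc ∘ backward)
  where
  tc : TC G
  tc = twoConn⇒TC twoConn
  forward : Tight G → IsC2 G ⊎ ClassA 2 G
  forward ti with n G ≟ 2
  ... | yes n≡2 = inj₁ (tight⇒C₂ tc ti n≡2)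
  ... | no n≢2 = inj₂ (tight⇒class (suc (n G)) G ≤-refl tc ti (≤∧≢⇒< (TC⇒2≤n tc) (n≢2 ∘ sym)))
  backward : IsC2 G ⊎ ClassA 2 G → Tight G
  backward (inj₁ c₂) = C₂⇒tight c₂
  backward (inj₂ a) = class⇒tight a
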